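{- Let $B$ and $R$ be two finite simple graphs with the same vertex set $V$. Then either the pair $(B,R)$ is additive, or at least one of the following holds: (1) one of $B, R$ contains a member of $\mathcal{F}$; (2) both $B$ and $R$ contain $C_5$; (3) both $B$ and $R$ contain $P_0^c$; (4) $B$ contains $P_0^c$, and $R$ contains a member of $\mathcal{P}$; (5) $R$ contains $P_0^c$, and $B$ contains a member of $\mathcal{P}$.
   Context: All graphs are finite and simple. A clique in a graph $G$ is a set of pairwise adjacent vertices, and $\omega(G)$ denotes the largest size of a clique in $G$. The complement $G^c$ of $G$ is the graph with vertex set $V(G)$ in which two (distinct) vertices are adjacent if and only if they are non-adjacent in $G$. A stable set of $G$ is a clique of $G^c$. For $X \subseteq V(G)$, $G|X$ is the subgraph of $G$ induced by $X$. A graph $G$ contains a graph $H$ if some induced subgraph of $G$ is isomorphic to $H$. $C_k$ denotes the cycle on $k$ vertices. For graphs $B$ and $R$ with the same vertex set $V$, $G(B,R)$ is the graph with vertex set $V$ in which two vertices are adjacent if they are adjacent in at least one of $B$ and $R$. The pair $(B,R)$ is additive if for every $X \subseteq V$, $$\omega(B|X)+\omega(R|X) \geq \omega(G(B,R)|X).$$ $\mathcal{F}$ is the family of graphs with vertex set $\{a_1,a_2,a_3,b_1,b_2,b_3\}$ (six distinct vertices) where $\{a_1,a_2,a_3\}$ and $\{b_1,b_2,b_3\}$ are cliques, $a_i$ is non-adjacent to $b_i$ for $i \in \{1,2,3\}$, and the remaining adjacencies (between $a_i$ and $b_j$ with $i \neq j$) are arbitrary. $P_0$ is the graph with vertex set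 $\{a_1,a_2,a_3,b_1,b_2,b_3,c\}$ (seven distinct vertices) where: $\{a_1,a_2,a_3\}$ is a clique; $\{b_1,b_2,b_3\}$ is a stable set; for $i \in \{1,2,3\}$, $b_i$ is non-adjacent to $a_i$ and adjacent to both vertices of $\{a_1,a_2,a_3\}\setminus\{a_i\}$; and $c$ is adjacent to $b_1$ and has no other neighbors in $P_0$. $P_1$ is the graph obtained from $P_0$ by adding the edge $cb_2$, and $P_2$ is the graph obtained from $P_1$ by adding the edge $cb_3$. Set $\mathcal{P}=\{P_0,P_1,P_2\}$. -}

module Defs where

open import Data.Empty using (⊥)
open import Data.Fin.Base using (Fin; zero; suc; toℕ)
open import Data.Fin.Patterns using (0F; 1F; 2F)
import Data.Fin.Properties as Fin
open import Data.Fin.Subset using (Subset; inside; outside; _∈_; ∣_∣; ⁅_⁆; _∪_)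
open import Data.Fin.Subset.Properties using (_∈?_)
open import Data.List.Base using (List; map; filter; _++_)
import Data.List.Base as List
open import Data.List.Extrema.Nat using (max)
open import Data.Nat.Base using (ℕ; zero; suc; _+_; _≥_)
open import Data.Nat.DivMod using (_%_)
import Data.Nat.Properties as ℕ
open import Data.Product.Base using (∃; _×_; _,_)
open import Data.Sum.Base using (_⊎_)
import Data.Sum.Base as Sum
open import Data.Vec.Base using ([]; _∷_)
open import Function.Base using (_∘_)
open import Function.Bundles using (_↔_; _⇔_; Inverse)
open import Level using (0ℓ; _⊔_) renaming (suc to lsuc)
open import Relation.Binary.Core using (Rel)
open import Relation.Binary.Definitions
  using (Symmetric; Irreflexive; Decidable; DecidableEquality)
import Relation.Binary.Construct.Union as Union
open import Relation.Binary.PropositionalEquality using (_≡_; _≢_; refl; sym; cong)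
open import Relation.Nullary using (¬_; Dec; yes; no; ¬?)
open import Relation.Nullary.Decidable using (map′; _×-dec_; _⊎-dec_; _→-dec_; from-yes)
open import Relation.Unary using (Pred)

private
  variable
    V W : Set
    n : ℕ

record Graph (V : Set) : Set₁ where
  field
    Adj        : Rel V 0ℓ
    adj?       : Decidable Adj
    adj-sym    : Symmetric Adj
    adj-irrefl : Irreflexive _≡_ Adj

open Graph public

complement : DecidableEquality V → Graph V → Graph V
complement _≟_ G = record
  { Adj        = λ u v → u ≢ v × ¬ Adj G u v
  ; adj?       = λ u v → ¬? (u ≟ v) ×-dec ¬? (adj? G u v)
  ; adj-sym    = λ (u≢v , ¬uv) → (u≢v ∘ sym) , (¬uv ∘ adj-sym G)
  ; adj-irrefl = λ u≡v (u≢v , _) → u≢v u≡v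
  }

-- G(B,R)
union : Graph V → Graph V → Graph V
union B R = record
  { Adj        = Adj B Union.∪ Adj R
  ; adj?       = Union.decidable (adj? B) (adj? R)
  ; adj-sym    = Union.symmetric {L = Adj B} {R = Adj R} (adj-sym B) (adj-sym R)
  ; adj-irrefl = λ u≡v → Sum.[ adj-irrefl B u≡v , adj-irrefl R u≡v ]
  }

-- The increasing enumeration of the elements of X.
element : (X : Subset n) → Fin ∣ X ∣ → Fin n
element (inside  ∷ X) zero    = zero
element (inside  ∷ X) (suc i) = suc (element X i)
element (outside ∷ X) i       = suc (element X i)

-- The induced subgraph G|X; its vertex i stands for the i-th element of X.
infixl 8 _↾_
_↾_ : Graph (Fin n) → (X : Subset n) → Graph (Fin ∣ X ∣)
G ↾ X = record
  { Adj        = λ i j → Adj G (element X i) (element X j)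
  ; adj?       = λ i j → adj? G (element X i) (element X j)
  ; adj-sym    = adj-sym G
  ; adj-irrefl = λ i≡j → adj-irrefl G (cong (element X) i≡j)
  }

Clique : Graph (Fin n) → Subset n → Set
Clique G S = ∀ u v → u ∈ S → v ∈ S → u ≢ v → Adj G u v

clique? : (G : Graph (Fin n)) (S : Subset n) → Dec (Clique G S)
clique? G S = Fin.all? λ u → Fin.all? λ v →
  (u ∈? S) →-dec ((v ∈? S) →-dec (¬? (u Fin.≟ v) →-dec adj? G u v))

subsets : ∀ n → List (Subset n)
subsets zero    = List.[ [] ]
subsets (suc n) = map (outside ∷_) (subsets n) ++ map (inside ∷_) (subsets n)

-- The default value 0 is the size of the empty clique.
ω : Graph (Fin n) → ℕ
ω {n} G = max 0 (map ∣_∣ (filter (clique? G) (subsets n)))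

Additive : Graph (Fin n) → Graph (Fin n) → Set
Additive {n} B R = (X : Subset n) → ω (B ↾ X) + ω (R ↾ X) ≥ ω (union B R ↾ X)

infix 4 _≅_
record _≅_ (G : Graph V) (H : Graph W) : Set where
  field
    bijection : V ↔ W
    adj⇔adj   : ∀ u v → Adj G u v ⇔ Adj H (Inverse.to bijection u) (Inverse.to bijection v)

Contains : Graph (Fin n) → Graph W → Set
Contains {n} G H = ∃ λ (X : Subset n) → G ↾ X ≅ H

ContainsMember : ∀ {ℓ} → Graph (Fin n) → Pred (Graph W) ℓ → Set (lsuc 0ℓ ⊔ ℓ)
ContainsMember G 𝓗 = ∃ λ H → 𝓗 H × Contains G H

C₅ : Graph (Fin 5)
C₅ = record
  { Adj        = λ i j → Next i j ⊎ Next j i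
  ; adj?       = λ i j → next? i j ⊎-dec next? j i
  ; adj-sym    = Sum.swap
  ; adj-irrefl = λ { {i} refl → Sum.[ next-irrefl i , next-irrefl i ] }
  }
  where
  Next : Rel (Fin 5) 0ℓ
  Next i j = toℕ j ≡ suc (toℕ i) % 5

  next? : Decidable Next
  next? i j = toℕ j ℕ.≟ suc (toℕ i) % 5

  next-irrefl : ∀ i → ¬ Next i i
  next-irrefl = from-yes (Fin.all? λ i → ¬? (next? i i))

data V₆ : Set where
  a b : Fin 3 → V₆

record 𝓕 (H : Graph V₆) : Set where
  field
    a-clique : ∀ i j → i ≢ j → Adj H (a i) (a j)
    b-clique : ∀ i j → i ≢ j → Adj H (b i) (b j)
    a-b      : ∀ i → ¬ Adj H (a i) (b i)

data V₇ : Set where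
  a b : Fin 3 → V₇
  c   : V₇

_≟₇_ : DecidableEquality V₇
a i ≟₇ a j = map′ (cong a) (λ { refl → refl }) (i Fin.≟ j)
a _ ≟₇ b _ = no λ ()
a _ ≟₇ c   = no λ ()
b _ ≟₇ a _ = no λ ()
b i ≟₇ b j = map′ (cong b) (λ { refl → refl }) (i Fin.≟ j)
b _ ≟₇ c   = no λ ()
c   ≟₇ a _ = no λ ()
c   ≟₇ b _ = no λ ()
c   ≟₇ c   = yes refl

-- The common shape of P₀, P₁ and P₂, which differ only in the set N of those i
-- for which b i is a neighbour of c.
P : Subset 3 → Graph V₇
P N = record { Adj = E ; adj? = E? ; adj-sym = E-sym ; adj-irrefl = E-irrefl }
  where
  E : Rel V₇ 0ℓ
  E (a i) (a j) = i ≢ j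
  E (a i) (b j) = i ≢ j
  E (a _) c     = ⊥
  E (b i) (a j) = i ≢ j
  E (b _) (b _) = ⊥
  E (b i) c     = i ∈ N
  E c     (a _) = ⊥
  E c     (b j) = j ∈ N
  E c     c     = ⊥

  E? : Decidable E
  E? (a i) (a j) = ¬? (i Fin.≟ j)
  E? (a i) (b j) = ¬? (i Fin.≟ j)
  E? (a _) c     = no λ ()
  E? (b i) (a j) = ¬? (i Fin.≟ j)
  E? (b _) (b _) = no λ ()
  E? (b i) c     = i ∈? N
  E? c     (a _) = no λ ()
  E? c     (b j) = j ∈? N
  E? c     c     = no λ ()

  E-sym : Symmetric E
  E-sym {a _} {a _} i≢j = i≢j ∘ sym
  E-sym {a _} {b _} i≢j = i≢j ∘ sym
  E-sym {b _} {a _} i≢j = i≢j ∘ sym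
  E-sym {b _} {c}   i∈N = i∈N
  E-sym {c}   {b _} j∈N = j∈N

  E-irrefl : Irreflexive _≡_ E
  E-irrefl {a _} refl i≢i = i≢i refl

P₀ P₁ P₂ : Graph V₇
P₀ = P ⁅ 0F ⁆
P₁ = P (⁅ 0F ⁆ ∪ ⁅ 1F ⁆)
P₂ = P (⁅ 0F ⁆ ∪ ⁅ 1F ⁆ ∪ ⁅ 2F ⁆)

P₀ᶜ : Graph V₇
P₀ᶜ = complement _≟₇_ P₀

data 𝓟 : Pred (Graph V₇) (lsuc 0ℓ) where
  P₀∈𝓟 : 𝓟 P₀
  P₁∈𝓟 : 𝓟 P₁
  P₂∈𝓟 : 𝓟 P₂

{-# OPTIONS --safe #-}
-- In a vertex-minimal counterexample the vertex set is a clique of G(B,R) with ω(B) + ω(R) + 1 elements,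
-- so that every vertex is avoided by some maximum clique of B, and by some maximum clique of R.  If B has
-- no member of 𝓕, Hall's condition shows that two maximum cliques of B differ in at most two vertices, and
-- for ω(B) ≥ 3 this forces a maximum clique K in which every u can be replaced by a "mate" outside K.
-- The mates are stable in B, hence a clique of R, so that ω(B) ≤ ω(R); by symmetry ω(B) = ω(R), and K,
-- its mates and one further vertex, the apex, exhaust the vertex set.  In B the apex sees either no vertex
-- of K, which gives a member of 𝓟, or exactly one vertex of K and its mate, which gives P₀ᶜ.  If the
-- former happens both in B and in R, then every vertex has two non-neighbours in R, so the apex of B has
-- two neighbours among the mates, and this gives a C₅ in B; likewise in R.
-- If ω(B) = ω(R) = 2, there are five vertices, and both graphs are pentagons.
module Submission where

open import Defs
open import Data.Bool.Base using (Bool; true; false)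
import Data.Bool.Properties as Bool
open import Data.Fin.Base using (Fin; zero; suc; toℕ; punchIn)
open import Data.Fin.Patterns using (0F; 1F; 2F; 3F; 4F)
import Data.Fin.Properties as Fin
open import Data.Fin.Subset using (Subset; inside; outside; ∣_∣; ⁅_⁆; _∪_) renaming (_∈_ to _∈ₛ_; ⊥ to ∅)
open import Data.Fin.Subset.Properties using (anySubset?; ∉⊥) renaming (_∈?_ to _∈ₛ?_)
open import Data.List.Base using (List; []; _∷_; map; filter; _++_; length; lookup; allFin)
open import Data.List.Extrema.Nat using (argmax-sel; xs≤max)
open import Data.List.Membership.Propositional using (_∈_; _∉_)
open import Data.List.Membership.Propositional.Properties
  using (∈-map⁺; ∈-map⁻; ∈-filter⁺; ∈-filter⁻; ∈-++⁺ˡ; ∈-++⁺ʳ; ∈-++⁻; ∈-allFin; ∈-lookup)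
import Data.List.Membership.DecPropositional as DecMembership
open import Data.List.Properties using (length-map; length-++; length-tabulate)
open import Data.List.Relation.Binary.Subset.Propositional using (_⊆_)
open import Data.List.Relation.Unary.All as All using (All; []; _∷_)
open import Data.List.Relation.Unary.AllPairs as AllPairs using (AllPairs; []; _∷_)
import Data.List.Relation.Unary.AllPairs.Properties as AllPairs
open import Data.List.Relation.Unary.Any using (here; there; index)
open import Data.List.Relation.Unary.Any.Properties using (lookup-index)
open import Data.List.Relation.Unary.Unique.Propositional using (Unique)
import Data.List.Relation.Unary.Unique.Propositional.Properties as Unique
open import Data.Nat.Base using (ℕ; zero; suc; _+_; _≤_; _<_; z≤n; s≤s)
open import Data.Nat.DivMod using (_mod_)
import Data.Nat.Properties as ℕ
open import Data.Product.Base using (∃; ∃₂; _×_; _,_; proj₁; proj₂)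
import Data.Product.Base as Product
open import Data.Sum.Base using (_⊎_; inj₁; inj₂)
import Data.Sum.Base as Sum
open import Data.Unit.Base using (⊤; tt)
open import Data.Vec.Base as Vec using ([]; _∷_; here; there)
open import Data.Vec.Properties using (lookup∘tabulate; lookup⇒[]=; []=⇒lookup)
open import Function.Base using (_∘_; id; case_of_)
open import Function.Bundles using (_⇔_; mk⇔; mk↔ₛ′; Equivalence)
open import Function.Definitions using (Injective)
open import Relation.Binary.PropositionalEquality
  using (_≡_; _≢_; refl; sym; trans; cong; cong₂; subst; subst₂; ≢-sym)
open import Relation.Nullary using (¬_; Dec; yes; no; ¬?; does; contradiction)
open import Relation.Nullary.Decidable
  using (map′; _×-dec_; _⊎-dec_; _→-dec_; decidable-stable; dec-true; from-yes; from-no)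
open import Relation.Unary using (Decidable)

private
  variable
    V W A : Set
    m n : ℕ

module _ {n : ℕ} where
  open DecMembership (Fin._≟_ {n}) public using (_∈?_)

-- Lists without repetition

lookup-injective : {xs : List A} → Unique xs → Injective _≡_ _≡_ (lookup xs)
lookup-injective {xs = x ∷ xs} (x∉ ∷ _) {zero}  {zero}  _  = refl
lookup-injective {xs = x ∷ xs} (x∉ ∷ _) {zero}  {suc j} eq = contradiction eq (All.lookup x∉ (∈-lookup j))
lookup-injective {xs = x ∷ xs} (x∉ ∷ _) {suc i} {zero}  eq = contradiction (sym eq) (All.lookup x∉ (∈-lookup i))
lookup-injective {xs = x ∷ xs} (_ ∷ u)  {suc i} {suc j} eq = cong suc (lookup-injective u eq)

unique-⊆⇒length≤ : {xs ys : List A} → Unique xs → xs ⊆ ys → length xs ≤ length ys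
unique-⊆⇒length≤ {xs = xs} {ys} unique xs⊆ys = Fin.injective⇒≤ {f = position} position-injective
  where
  position : Fin (length xs) → Fin (length ys)
  position i = index (xs⊆ys (∈-lookup i))

  position-injective : Injective _≡_ _≡_ position
  position-injective {i} {j} eq = lookup-injective unique
    (trans (lookup-index (xs⊆ys (∈-lookup i)))
      (trans (cong (lookup ys) eq) (sym (lookup-index (xs⊆ys (∈-lookup j))))))

∉⇒All≢ : {x : A} {xs : List A} → x ∉ xs → All (x ≢_) xs
∉⇒All≢ x∉xs = All.tabulate λ { y∈xs refl → x∉xs y∈xs }

fresh : {xs : List (Fin n)} → Unique xs → (ys : List (Fin n)) → length ys < length xs →
        ∃ λ x → x ∈ xs × x ∉ ys
fresh {xs = xs} unique ys ys<xs with Fin.any? (λ x → (x ∈? xs) ×-dec ¬? (x ∈? ys))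
... | yes found = found
... | no none   = contradiction
  (unique-⊆⇒length≤ unique λ {x} x∈xs → decidable-stable (x ∈? ys) λ x∉ys → none (x , x∈xs , x∉ys))
  (ℕ.<⇒≱ ys<xs)

length-allFin : ∀ n → length (allFin n) ≡ n
length-allFin n = length-tabulate {n = n} id

unique⇒length≤ : {xs : List (Fin n)} → Unique xs → length xs ≤ n
unique⇒length≤ {n} {xs} unique =
  subst (length xs ≤_) (length-allFin n) (unique-⊆⇒length≤ unique λ _ → ∈-allFin _)

-- Cliques as lists

IsClique : Graph V → List V → Set
IsClique G = AllPairs (Adj G)

infix 4 _[_≁_]
_[_≁_] : Graph V → V → V → Set
G [ u ≁ v ] = u ≢ v × ¬ Adj G u v

≁-sym : (G : Graph V) {u v : V} → G [ u ≁ v ] → G [ v ≁ u ]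
≁-sym G (u≢v , u≁v) = ≢-sym u≢v , u≁v ∘ adj-sym G

≁? : (G : Graph (Fin n)) (u v : Fin n) → Dec (G [ u ≁ v ])
≁? G u v = ¬? (u Fin.≟ v) ×-dec ¬? (adj? G u v)

adj⇒≢ : (G : Graph V) {u v : V} → Adj G u v → u ≢ v
adj⇒≢ G uv u≡v = adj-irrefl G u≡v uv

clique-unique : (G : Graph V) {xs : List V} → IsClique G xs → Unique xs
clique-unique G = AllPairs.map (adj⇒≢ G)

clique-adj : (G : Graph V) {xs : List V} → IsClique G xs →
             ∀ {u v} → u ∈ xs → v ∈ xs → u ≢ v → Adj G u v
clique-adj G (_ ∷ _)  (here refl) (here refl) u≢v = contradiction refl u≢v
clique-adj G (ux ∷ _) (here refl) (there v∈)  _   = All.lookup ux v∈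
clique-adj G (ux ∷ _) (there u∈)  (here refl) _   = adj-sym G (All.lookup ux u∈)
clique-adj G (_ ∷ ps) (there u∈)  (there v∈)  u≢v = clique-adj G ps u∈ v∈ u≢v

mkClique : (G : Graph V) {xs : List V} → Unique xs →
           (∀ {u v} → u ∈ xs → v ∈ xs → u ≢ v → Adj G u v) → IsClique G xs
mkClique G []           _   = []
mkClique G (x∉xs ∷ uxs) adj =
  All.tabulate (λ y∈xs → adj (here refl) (there y∈xs) (All.lookup x∉xs y∈xs))
  ∷ mkClique G uxs λ u∈ v∈ → adj (there u∈) (there v∈)

-- The clique number in terms of lists

element∈ : (X : Subset n) (i : Fin ∣ X ∣) → element X i ∈ₛ X
element∈ (inside  ∷ X) zero    = here
element∈ (inside  ∷ X) (suc i) = there (element∈ X i)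
element∈ (outside ∷ X) i       = there (element∈ X i)

element-injective : (X : Subset n) → Injective _≡_ _≡_ (element X)
element-injective (inside  ∷ X) {zero}  {zero}  _  = refl
element-injective (inside  ∷ X) {suc i} {suc j} eq = cong suc (element-injective X (Fin.suc-injective eq))
element-injective (outside ∷ X) eq                 = element-injective X (Fin.suc-injective eq)

element-surjective : (X : Subset n) {x : Fin n} → x ∈ₛ X → ∃ λ i → element X i ≡ x
element-surjective (inside  ∷ X) here = zero , refl
element-surjective (inside  ∷ X) (there x∈X) with i , eq ← element-surjective X x∈X = suc i , cong suc eq
element-surjective (outside ∷ X) (there x∈X) with i , eq ← element-surjective X x∈X = i , cong suc eq

elements : (X : Subset n) → List (Fin n)
elements X = map (element X) (allFin ∣ X ∣)

length-elements : (X : Subset n) → length (elements X) ≡ ∣ X ∣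
length-elements X = trans (length-map (element X) (allFin ∣ X ∣)) (length-allFin ∣ X ∣)

elements-unique : (X : Subset n) → Unique (elements X)
elements-unique X = Unique.map⁺ (element-injective X) (Unique.allFin⁺ ∣ X ∣)

∈⇒∈-elements : (X : Subset n) {x : Fin n} → x ∈ₛ X → x ∈ elements X
∈⇒∈-elements X x∈X with i , refl ← element-surjective X x∈X = ∈-map⁺ (element X) (∈-allFin i)

∈-elements⇒∈ : (X : Subset n) {x : Fin n} → x ∈ elements X → x ∈ₛ X
∈-elements⇒∈ X x∈ with i , _ , refl ← ∈-map⁻ (element X) x∈ = element∈ X i

module _ {P : Fin n → Set} (P? : Decidable P) where

  comprehension : Subset n
  comprehension = Vec.tabulate (does ∘ P?)

  ∈-comprehension⁺ : ∀ {x} → P x → x ∈ₛ comprehension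
  ∈-comprehension⁺ {x} px = lookup⇒[]= x comprehension
    (trans (lookup∘tabulate (does ∘ P?) x) (dec-true (P? x) px))

  ∈-comprehension⁻ : ∀ {x} → x ∈ₛ comprehension → P x
  ∈-comprehension⁻ {x} x∈ with P? x | trans (sym (lookup∘tabulate (does ∘ P?) x)) ([]=⇒lookup x∈)
  ... | yes px | _ = px

∈-subsets : (X : Subset n) → X ∈ subsets n
∈-subsets Vec.[]        = here refl
∈-subsets (outside ∷ X) = ∈-++⁺ˡ (∈-map⁺ (outside ∷_) (∈-subsets X))
∈-subsets {suc n} (inside ∷ X) = ∈-++⁺ʳ (map (outside ∷_) (subsets n)) (∈-map⁺ (inside ∷_) (∈-subsets X))

clique⇒length≤ω : (G : Graph (Fin n)) {xs : List (Fin n)} → IsClique G xs → length xs ≤ ω G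
clique⇒length≤ω {n} G {xs} clique = ℕ.≤-trans length≤∣X∣
  (All.lookup (xs≤max 0 (map ∣_∣ (filter (clique? G) (subsets n))))
    (∈-map⁺ ∣_∣ (∈-filter⁺ (clique? G) (∈-subsets X) X-clique)))
  where
  X : Subset n
  X = comprehension (_∈? xs)

  X-clique : Clique G X
  X-clique u v u∈X v∈X =
    clique-adj G clique (∈-comprehension⁻ (_∈? xs) u∈X) (∈-comprehension⁻ (_∈? xs) v∈X)

  length≤∣X∣ : length xs ≤ ∣ X ∣
  length≤∣X∣ = subst (length xs ≤_) (length-elements X)
    (unique-⊆⇒length≤ (clique-unique G clique) (∈⇒∈-elements X ∘ ∈-comprehension⁺ (_∈? xs)))

ω-attained : (G : Graph (Fin n)) → ∃ λ xs → IsClique G xs × length xs ≡ ω G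
ω-attained {n} G with argmax-sel id 0 (map ∣_∣ (filter (clique? G) (subsets n)))
... | inj₁ ω≡0 = [] , [] , sym ω≡0
... | inj₂ ω∈
  with X , X∈ , ω≡∣X∣ ← ∈-map⁻ ∣_∣ ω∈
  with _ , clique ← ∈-filter⁻ (clique? G) {xs = subsets n} X∈
  = elements X
  , mkClique G (elements-unique X) (λ u∈ v∈ → clique _ _ (∈-elements⇒∈ X u∈) (∈-elements⇒∈ X v∈))
  , trans (length-elements X) (sym ω≡∣X∣)

opaque
  -- An opaque copy of ω, so that its search through all subsets is never unfolded.
  ν : Graph (Fin n) → ℕ
  ν = ω

  ν≡ω : (G : Graph (Fin n)) → ν G ≡ ω G
  ν≡ω G = refl

  clique⇒length≤ν : (G : Graph (Fin n)) {xs : List (Fin n)} → IsClique G xs → length xs ≤ ν G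
  clique⇒length≤ν = clique⇒length≤ω

  ν-attained : (G : Graph (Fin n)) → ∃ λ xs → IsClique G xs × length xs ≡ ν G
  ν-attained = ω-attained

-- Induced subgraphs as embeddings

induced : (W → V) → Graph V → Graph W
induced f G = record
  { Adj        = λ u v → Adj G (f u) (f v)
  ; adj?       = λ u v → adj? G (f u) (f v)
  ; adj-sym    = adj-sym G
  ; adj-irrefl = λ u≡v → adj-irrefl G (cong f u≡v)
  }

ν-induced≤ν : (f : Fin m → Fin n) (G : Graph (Fin n)) → ν (induced f G) ≤ ν G
ν-induced≤ν f G with xs , clique , eq ← ν-attained (induced f G) =
  subst (_≤ ν G) (trans (length-map f xs) eq) (clique⇒length≤ν G (AllPairs.map⁺ clique))

infix 4 _↪_
record _↪_ (H : Graph W) (G : Graph V) : Set where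
  field
    embed     : W → V
    injective : Injective _≡_ _≡_ embed
    adj⇔      : ∀ u v → Adj H u v ⇔ Adj G (embed u) (embed v)

open _↪_

module _ {G : Graph V} (f : W → V) (f-injective : Injective _≡_ _≡_ f) where

  ↪-induced : {U : Set} {H : Graph U} → H ↪ induced f G → H ↪ G
  ↪-induced e = record
    { embed     = f ∘ embed e
    ; injective = injective e ∘ f-injective
    ; adj⇔      = adj⇔ e
    }

-- The image of an embedding can be turned into a `Subset` once membership in it is decidable, and
-- this is a search through the vertices of the embedded graph.
Searchable : Set → Set₁
Searchable W = {P : W → Set} → Decidable P → Dec (∃ P)

V₆-searchable : Searchable V₆
V₆-searchable P? = map′
  Sum.[ (λ (i , p) → a i , p) , (λ (i , p) → b i , p) ]
  (λ { (a i , p) → inj₁ (i , p) ; (b i , p) → inj₂ (i , p) })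
  (Fin.any? (P? ∘ a) ⊎-dec Fin.any? (P? ∘ b))

V₇-searchable : Searchable V₇
V₇-searchable P? = map′
  Sum.[ (λ (i , p) → a i , p) , Sum.[ (λ (i , p) → b i , p) , (c ,_) ] ]
  (λ { (a i , p) → inj₁ (i , p) ; (b i , p) → inj₂ (inj₁ (i , p)) ; (c , p) → inj₂ (inj₂ p) })
  (Fin.any? (P? ∘ a) ⊎-dec Fin.any? (P? ∘ b) ⊎-dec P? c)

↪⇒Contains : Searchable W → {G : Graph (Fin n)} {H : Graph W} → H ↪ G → Contains G H
↪⇒Contains {W = W} {n} search {G} {H} e = X , record
  { bijection = mk↔ₛ′ to from to-from from-to
  ; adj⇔adj   = λ i j → mk⇔
      (λ ij → Equivalence.from (adj⇔ e (to i) (to j))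
        (subst₂ (Adj G) (sym (embed-to i)) (sym (embed-to j)) ij))
      (λ uv → subst₂ (Adj G) (embed-to i) (embed-to j)
        (Equivalence.to (adj⇔ e (to i) (to j)) uv))
  }
  where
  image? : Decidable λ x → ∃ λ w → embed e w ≡ x
  image? x = search λ w → embed e w Fin.≟ x

  X : Subset n
  X = comprehension image?

  preimage : (i : Fin ∣ X ∣) → ∃ λ w → embed e w ≡ element X i
  preimage i = ∈-comprehension⁻ image? (element∈ X i)

  to : Fin ∣ X ∣ → W
  to i = proj₁ (preimage i)

  embed-to : ∀ i → embed e (to i) ≡ element X i
  embed-to i = proj₂ (preimage i)

  position : (w : W) → ∃ λ i → element X i ≡ embed e w
  position w = element-surjective X (∈-comprehension⁺ image? (w , refl))

  from : W → Fin ∣ X ∣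
  from w = proj₁ (position w)

  to-from : ∀ w → to (from w) ≡ w
  to-from w = injective e (trans (embed-to (from w)) (proj₂ (position w)))

  from-to : ∀ i → from (to i) ≡ i
  from-to i = element-injective X (trans (proj₂ (position (to i))) (embed-to i))

-- Maximum cliques

Triangle : Graph V → V → V → V → Set
Triangle G x y z = Adj G x y × Adj G x z × Adj G y z

triangle? : (G : Graph V) (x y z : V) → Dec (Triangle G x y z)
triangle? G x y z = adj? G x y ×-dec adj? G x z ×-dec adj? G y z

-- A member of `𝓕` inside `G`, given by six explicit vertices so that a finite search decides its
-- presence.
AntimatchedTriangles : Graph V → Set
AntimatchedTriangles {V} G =
  ∃ λ x₁ → ∃ λ x₂ → ∃ λ x₃ → ∃ λ y₁ → ∃ λ y₂ → ∃ λ y₃ →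
    Triangle G x₁ x₂ x₃ × Triangle G y₁ y₂ y₃ × G [ x₁ ≁ y₁ ] × G [ x₂ ≁ y₂ ] × G [ x₃ ≁ y₃ ]

antimatchedTriangles? : (G : Graph (Fin n)) → Dec (AntimatchedTriangles G)
antimatchedTriangles? G =
  Fin.any? λ x₁ → Fin.any? λ x₂ → Fin.any? λ x₃ → Fin.any? λ y₁ → Fin.any? λ y₂ → Fin.any? λ y₃ →
    triangle? G x₁ x₂ x₃ ×-dec triangle? G y₁ y₂ y₃ ×-dec
    ≁? G x₁ y₁ ×-dec ≁? G x₂ y₂ ×-dec ≁? G x₃ y₃

-- Completeness of `union G H`, in the form that turns a non-neighbour in `G` into a neighbour in
-- `H`.
Covering : Graph V → Graph V → Set
Covering G H = ∀ {u v} → G [ u ≁ v ] → Adj H u v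

covering-sym : {G H : Graph V} → Covering G H → Covering H G
covering-sym {G = G} cover {u} {v} (u≢v , u≁v) = decidable-stable (adj? G u v) λ ¬uv → u≁v (cover (u≢v , ¬uv))

IsMaxClique : Graph (Fin n) → List (Fin n) → Set
IsMaxClique G K = IsClique G K × length K ≡ ν G

module Exchange {n : ℕ} (G : Graph (Fin n)) where

  -- `xs` together with the vertices of `K` outside `ys` is again a clique, so it is no longer than
  -- the maximum clique `K`.
  exchange : ∀ {K xs} → IsMaxClique G K → IsClique G xs → (∀ {x} → x ∈ xs → x ∉ K) → (ys : List (Fin n)) →
             (∀ {x y} → x ∈ xs → y ∈ K → y ∉ ys → Adj G x y) → length xs ≤ length ys
  exchange {K} {xs} (K-clique , K-max) xs-clique xs∉K ys adj =
    ℕ.+-cancelʳ-≤ (length rest) (length xs) (length ys) (begin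
      length xs + length rest ≡⟨ sym (length-++ xs) ⟩
      length (xs ++ rest)     ≤⟨ clique⇒length≤ν G new-clique ⟩
      ν G                     ≡⟨ sym K-max ⟩
      length K                ≤⟨ unique-⊆⇒length≤ (clique-unique G K-clique) K⊆ys++rest ⟩
      length (ys ++ rest)     ≡⟨ length-++ ys ⟩
      length ys + length rest ∎)
    where
    open ℕ.≤-Reasoning

    rest : List (Fin n)
    rest = filter (λ y → ¬? (y ∈? ys)) K

    rest⇒ : ∀ {y} → y ∈ rest → y ∈ K × y ∉ ys
    rest⇒ = ∈-filter⁻ (λ y → ¬? (y ∈? ys))

    K⊆ys++rest : K ⊆ ys ++ rest
    K⊆ys++rest {y} y∈K with y ∈? ys
    ... | yes y∈ys = ∈-++⁺ˡ y∈ys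
    ... | no  y∉ys = ∈-++⁺ʳ ys (∈-filter⁺ (λ y → ¬? (y ∈? ys)) y∈K y∉ys)

    new-clique : IsClique G (xs ++ rest)
    new-clique = AllPairs.++⁺ xs-clique (AllPairs.filter⁺ (λ y → ¬? (y ∈? ys)) K-clique)
      (All.tabulate λ x∈xs → All.tabulate λ y∈rest →
        adj x∈xs (proj₁ (rest⇒ y∈rest)) (proj₂ (rest⇒ y∈rest)))

  -- Hall's condition for the bipartite graph of non-adjacent pairs between `xs` and `K`. The three
  -- `antimatch` lemmas extract matchings of sizes one, two and three from it.
  blocked : ∀ {K xs} → IsMaxClique G K → IsClique G xs → (∀ {x} → x ∈ xs → x ∉ K) →
            (ys : List (Fin n)) → length ys < length xs →
            ∃₂ λ x y → x ∈ xs × y ∈ K × y ∉ ys × G [ x ≁ y ]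
  blocked {K} {xs} K-max xs-clique xs∉K ys ys<xs
    with Fin.any? (λ x → Fin.any? λ y → (x ∈? xs) ×-dec (y ∈? K) ×-dec ¬? (y ∈? ys) ×-dec ≁? G x y)
  ... | yes found = found
  ... | no none   = contradiction
    (exchange K-max xs-clique xs∉K ys λ {x} {y} x∈xs y∈K y∉ys →
      decidable-stable (adj? G x y) λ x≁y →
        none (x , y , x∈xs , y∈K , y∉ys , (λ { refl → xs∉K x∈xs y∈K }) , x≁y))
    (ℕ.<⇒≱ ys<xs)

  module _ {L : List (Fin n)} (L-max : IsMaxClique G L) where

    antimatch₁ : ∀ {x} → x ∉ L → ∃ λ y → y ∈ L × G [ x ≁ y ]
    antimatch₁ x∉L with blocked L-max ([] ∷ []) (λ { (here refl) → x∉L }) [] (s≤s z≤n)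
    ... | _ , y , here refl , y∈L , _ , x≁y = y , y∈L , x≁y

    antimatch₂ : ∀ {x₁ x₂} → x₁ ∉ L → x₂ ∉ L → Adj G x₁ x₂ →
                 ∃₂ λ y₁ y₂ → y₁ ∈ L × y₂ ∈ L × y₁ ≢ y₂ × G [ x₁ ≁ y₁ ] × G [ x₂ ≁ y₂ ]
    antimatch₂ x₁∉L x₂∉L x₁x₂
      with y₁ , y₁∈L , x₁≁y₁ ← antimatch₁ x₁∉L
      with blocked L-max ((x₁x₂ ∷ []) ∷ [] ∷ [])
             (λ { (here refl) → x₁∉L ; (there (here refl)) → x₂∉L }) (y₁ ∷ []) (s≤s (s≤s z≤n))
    ... | _ , y , there (here refl) , y∈L , y∉ , x₂≁y =
      y₁ , y , y₁∈L , y∈L , (λ { refl → y∉ (here refl) }) , x₁≁y₁ , x₂≁y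
    -- Now `x₁` may choose between `y₁` and `y`, and the partner of `x₂` equals at most one of them.
    ... | _ , y , here refl , y∈L , y∉ , x₁≁y
      with y₂ , y₂∈L , x₂≁y₂ ← antimatch₁ x₂∉L
      with y₂ Fin.≟ y₁
    ... | yes refl = y , y₂ , y∈L , y₂∈L , (λ { refl → y∉ (here refl) }) , x₁≁y , x₂≁y₂
    ... | no y₂≢y₁ = y₁ , y₂ , y₁∈L , y₂∈L , ≢-sym y₂≢y₁ , x₁≁y₁ , x₂≁y₂

    Antimatching₃ : (x₁ x₂ x₃ : Fin n) → Set
    Antimatching₃ x₁ x₂ x₃ = ∃ λ y₁ → ∃ λ y₂ → ∃ λ y₃ → y₁ ∈ L × y₂ ∈ L × y₃ ∈ L ×
      y₁ ≢ y₂ × y₁ ≢ y₃ × y₂ ≢ y₃ × G [ x₁ ≁ y₁ ] × G [ x₂ ≁ y₂ ] × G [ x₃ ≁ y₃ ]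

    private
      -- Two choices y, y′ for x₁ leave one that avoids the partner of x₃.
      spare-choice : ∀ {x₁ x₂ x₃ y y′ y₂} → x₂ ∉ L → x₃ ∉ L → Adj G x₂ x₃ →
        y ∈ L → y′ ∈ L → y₂ ∈ L → y ≢ y′ → y ≢ y₂ → y′ ≢ y₂ →
        G [ x₁ ≁ y ] → G [ x₁ ≁ y′ ] → G [ x₂ ≁ y₂ ] → Antimatching₃ x₁ x₂ x₃
      spare-choice {x₁} {y = y} {y′} {y₂} x₂∉L x₃∉L x₂x₃ y∈ y′∈ y₂∈ y≢y′ y≢y₂ y′≢y₂ x₁≁y x₁≁y′ x₂≁y₂
        with u₂ , u₃ , u₂∈ , u₃∈ , u₂≢u₃ , x₂≁u₂ , x₃≁u₃ ← antimatch₂ x₂∉L x₃∉L x₂x₃ = result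
        where
        avoiding : ∀ u → ∃ λ w → w ∈ L × w ≢ y₂ × w ≢ u × G [ x₁ ≁ w ]
        avoiding u with y Fin.≟ u
        ... | no y≢u   = y , y∈ , y≢y₂ , y≢u , x₁≁y
        ... | yes refl = y′ , y′∈ , y′≢y₂ , ≢-sym y≢y′ , x₁≁y′

        result : Antimatching₃ _ _ _
        -- `x₂` keeps `y₂` unless `x₃` claims it, and then takes `u₂`. Either way `y₂` is in use, so
        -- only one further vertex has to be avoided by the choice for `x₁`.
        result with u₃ Fin.≟ y₂
        ... | no u₃≢y₂ with w , w∈ , w≢y₂ , w≢u₃ , x₁≁w ← avoiding u₃ =
          w , y₂ , u₃ , w∈ , y₂∈ , u₃∈ , w≢y₂ , w≢u₃ , ≢-sym u₃≢y₂ , x₁≁w , x₂≁y₂ , x₃≁u₃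
        ... | yes refl with w , w∈ , w≢y₂ , w≢u₂ , x₁≁w ← avoiding u₂ =
          w , u₂ , u₃ , w∈ , u₂∈ , u₃∈ , w≢u₂ , w≢y₂ , u₂≢u₃ , x₁≁w , x₂≁u₂ , x₃≁u₃

    -- Once `x₁` and `x₂` have partners, Hall's condition yields a third vertex `y` missed by some
    -- `xᵢ`. If this is `x₃`, the matching is complete; otherwise that `xᵢ` has two choices and
    -- `spare-choice` applies.
    antimatch₃ : ∀ {x₁ x₂ x₃} → x₁ ∉ L → x₂ ∉ L → x₃ ∉ L → Triangle G x₁ x₂ x₃ → Antimatching₃ x₁ x₂ x₃
    antimatch₃ {x₁} {x₂} {x₃} x₁∉L x₂∉L x₃∉L (x₁x₂ , x₁x₃ , x₂x₃)
      with y₁ , y₂ , y₁∈ , y₂∈ , y₁≢y₂ , x₁≁y₁ , x₂≁y₂ ← antimatch₂ x₁∉L x₂∉L x₁x₂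
      with blocked {xs = x₁ ∷ x₂ ∷ x₃ ∷ []} L-max ((x₁x₂ ∷ x₁x₃ ∷ []) ∷ (x₂x₃ ∷ []) ∷ [] ∷ [])
             (λ { (here refl) → x₁∉L ; (there (here refl)) → x₂∉L ; (there (there (here refl))) → x₃∉L })
             (y₁ ∷ y₂ ∷ []) (s≤s (s≤s (s≤s z≤n)))
    ... | _ , y , x∈ , y∈ , y∉ , x≁y = choose x∈ x≁y
      where
      y≢y₁ : y ≢ y₁
      y≢y₁ refl = y∉ (here refl)

      y≢y₂ : y ≢ y₂
      y≢y₂ refl = y∉ (there (here refl))

      choose : ∀ {x} → x ∈ x₁ ∷ x₂ ∷ x₃ ∷ [] → G [ x ≁ y ] → Antimatching₃ x₁ x₂ x₃
      choose (here refl) x₁≁y =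
        spare-choice x₂∉L x₃∉L x₂x₃ y∈ y₁∈ y₂∈ y≢y₁ y≢y₂ y₁≢y₂ x₁≁y x₁≁y₁ x₂≁y₂
      choose (there (here refl)) x₂≁y
        with u₂ , u₁ , u₃ , u₂∈ , u₁∈ , u₃∈ , u₂≢u₁ , u₂≢u₃ , u₁≢u₃ , x₂≁u₂ , x₁≁u₁ , x₃≁u₃ ←
          spare-choice x₁∉L x₃∉L x₁x₃ y∈ y₂∈ y₁∈ y≢y₂ y≢y₁ (≢-sym y₁≢y₂) x₂≁y x₂≁y₂ x₁≁y₁
        = u₁ , u₂ , u₃ , u₁∈ , u₂∈ , u₃∈ , ≢-sym u₂≢u₁ , u₁≢u₃ , u₂≢u₃ , x₁≁u₁ , x₂≁u₂ , x₃≁u₃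
      choose (there (there (here refl))) x₃≁y =
        y₁ , y₂ , y , y₁∈ , y₂∈ , y∈ , y₁≢y₂ , ≢-sym y≢y₁ , ≢-sym y≢y₂ , x₁≁y₁ , x₂≁y₂ , x₃≁y

-- Maximum cliques in which every vertex can be replaced

module Center {n : ℕ} (G : Graph (Fin n)) (𝓕-free : ¬ AntimatchedTriangles G) where
  open Exchange G

  -- Three vertices of `K` outside `L` form a triangle, and `antimatch₃` finds an antimatched
  -- triangle in `L`. Hence two vertices of `K` outside `L` force all others into `L`.
  near : ∀ {K L} → IsMaxClique G K → IsMaxClique G L → ∀ {x₁ x₂ x₃} →
         x₁ ∈ K → x₂ ∈ K → x₃ ∈ K → x₁ ≢ x₂ → x₁ ≢ x₃ → x₂ ≢ x₃ →
         x₁ ∉ L → x₂ ∉ L → x₃ ∈ L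
  near {K} {L} (K-clique , _) L-max@(L-clique , _) {x₁} {x₂} {x₃} x₁∈ x₂∈ x₃∈ x₁≢x₂ x₁≢x₃ x₂≢x₃ x₁∉L x₂∉L =
    decidable-stable (x₃ ∈? L) λ x₃∉L →
      let triangle = clique-adj G K-clique x₁∈ x₂∈ x₁≢x₂ , clique-adj G K-clique x₁∈ x₃∈ x₁≢x₃
                   , clique-adj G K-clique x₂∈ x₃∈ x₂≢x₃
          y₁ , y₂ , y₃ , y₁∈ , y₂∈ , y₃∈ , y₁≢y₂ , y₁≢y₃ , y₂≢y₃ , ≁₁ , ≁₂ , ≁₃ =
            antimatch₃ L-max x₁∉L x₂∉L x₃∉L triangle
      in 𝓕-free (x₁ , x₂ , x₃ , y₁ , y₂ , y₃ , triangle
           , (clique-adj G L-clique y₁∈ y₂∈ y₁≢y₂ , clique-adj G L-clique y₁∈ y₃∈ y₁≢y₃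
             , clique-adj G L-clique y₂∈ y₃∈ y₂≢y₃)
           , ≁₁ , ≁₂ , ≁₃)

  record Centre : Set where
    field
      K         : List (Fin n)
      K-max     : IsMaxClique G K
      mate      : Fin n → Fin n
      mate∉K    : ∀ {u} → u ∈ K → mate u ∉ K
      mate-adj  : ∀ {u x} → u ∈ K → x ∈ K → x ≢ u → Adj G (mate u) x

  Replacement : List (Fin n) → Fin n → Set
  Replacement K u = ∃ λ y → y ∉ K × (∀ {x} → x ∈ K → x ≢ u → Adj G y x)

  -- If `L` omits only `u` from `K`, then a vertex of `L` missed by `u` sees the rest of `K`, and it
  -- lies outside `K` because `u` misses it.
  replacement : ∀ {K L u} → IsMaxClique G K → IsMaxClique G L → u ∈ K → u ∉ L →
                (∀ {x} → x ∈ K → x ≢ u → x ∈ L) → Replacement K u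
  replacement {K} (K-clique , _) L-max@(L-clique , _) u∈K u∉L K-u⊆L
    with y , y∈L , u≢y , u≁y ← antimatch₁ L-max u∉L
    = y , y∉K , λ x∈K x≢u → clique-adj G L-clique y∈L (K-u⊆L x∈K x≢u) λ { refl → y∉K x∈K }
    where
    y∉K : y ∉ K
    y∉K y∈K = u≁y (clique-adj G K-clique u∈K y∈K u≢y)

  replacements⇒centre : ∀ {K} → IsMaxClique G K → (∀ {u} → u ∈ K → Replacement K u) → Centre
  replacements⇒centre {K} K-max replace = record
    { K        = K
    ; K-max    = K-max
    ; mate     = λ u → proj₁ (choice u)
    ; mate∉K   = λ {u} u∈K → proj₁ (proj₂ (choice u) u∈K)
    ; mate-adj = λ {u} u∈K → proj₂ (proj₂ (choice u) u∈K)
    }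
    where
    choice : ∀ u → ∃ λ y → u ∈ K → y ∉ K × (∀ {x} → x ∈ K → x ≢ u → Adj G y x)
    choice u with u ∈? K
    ... | yes u∈K = let y , replaces = replace u∈K in y , λ _ → replaces
    -- A mate is meaningful only for vertices of `K`; here `u` is a default value.
    ... | no  u∉K = u , λ u∈K → contradiction u∈K u∉K

  module _ (avoid : ∀ u → ∃ λ L → IsMaxClique G L × u ∉ L) where

    private
      ⟨_⟩ : Fin n → List (Fin n)
      ⟨ u ⟩ = proj₁ (avoid u)

      max : ∀ u → IsMaxClique G ⟨ u ⟩
      max u = proj₁ (proj₂ (avoid u))

      avoids : ∀ u → u ∉ ⟨ u ⟩
      avoids u = proj₂ (proj₂ (avoid u))

      not-both : ∀ {L x y} → IsMaxClique G L → G [ x ≁ y ] → x ∈ L → y ∉ L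
      not-both (L-clique , _) (x≢y , x≁y) x∈L y∈L = x≁y (clique-adj G L-clique x∈L y∈L x≢y)

      module Pair {K L v w p q} (K-max : IsMaxClique G K) (L-max : IsMaxClique G L)
        (v∈K : v ∈ K) (w∈K : w ∈ K) (v≢w : v ≢ w) (v∉L : v ∉ L) (w∉L : w ∉ L)
        (p∈L : p ∈ L) (q∈L : q ∈ L) (p≢q : p ≢ q) (v≁p : G [ v ≁ p ]) (w≁q : G [ w ≁ q ]) where

        p∉K : p ∉ K
        p∉K = not-both K-max v≁p v∈K

        q∉K : q ∉ K
        q∉K = not-both K-max w≁q w∈K

        K-vw⊆L : ∀ {x} → x ∈ K → x ≢ v → x ≢ w → x ∈ L
        K-vw⊆L x∈K x≢v x≢w = near K-max L-max v∈K w∈K x∈K v≢w (≢-sym x≢v) (≢-sym x≢w) v∉L w∉L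

        -- As `⟨ u ⟩` omits `u`, it omits at most one more vertex of `K`, so it contains `v` or `w`.
        -- If it contains `v`, it omits `p`; then `u` and `p` are two vertices of `L` outside it,
        -- which forces `q` into it. The case of `w` is symmetric.
        mixed : ∀ {u} → u ∈ K → u ≢ v → u ≢ w → (v ∈ ⟨ u ⟩ × q ∈ ⟨ u ⟩) ⊎ (w ∈ ⟨ u ⟩ × p ∈ ⟨ u ⟩)
        mixed {u} u∈K u≢v u≢w with v ∈? ⟨ u ⟩
        ... | yes v∈ = inj₁ (v∈ , near L-max (max u) (K-vw⊆L u∈K u≢v u≢w) p∈L q∈L
          (λ { refl → p∉K u∈K }) (λ { refl → q∉K u∈K }) p≢q (avoids u) (not-both (max u) v≁p v∈))
        ... | no v∉ = inj₂ (w∈ , near L-max (max u) (K-vw⊆L u∈K u≢v u≢w) q∈L p∈L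
          (λ { refl → q∉K u∈K }) (λ { refl → p∉K u∈K }) (≢-sym p≢q) (avoids u) (not-both (max u) w≁q w∈))
          where
          w∈ : w ∈ ⟨ u ⟩
          w∈ = near K-max (max u) u∈K v∈K w∈K u≢v u≢w v≢w (avoids u) v∉

        module _ {u₀} (u₀∈K : u₀ ∈ K) (u₀≢v : u₀ ≢ v) (u₀≢w : u₀ ≢ w)
          (v∈₀ : v ∈ ⟨ u₀ ⟩) (q∈₀ : q ∈ ⟨ u₀ ⟩) where

          v≢q : v ≢ q
          v≢q refl = q∉K v∈K

          -- Otherwise `⟨ u ⟩` contains `w` and `p`, hence neither `v` nor `q`. But `⟨ u₀ ⟩` omits
          -- `u₀` and `w`, so it contains `u` besides `v` and `q`, and `near` would put `u` into
          -- `⟨ u ⟩`.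
          q∈⟨⟩ : ∀ {u} → u ∈ K → u ≢ v → u ≢ w → q ∈ ⟨ u ⟩
          q∈⟨⟩ {u} u∈K u≢v u≢w with mixed u∈K u≢v u≢w | u Fin.≟ u₀
          ... | inj₁ (_ , q∈) | _        = q∈
          ... | inj₂ (_ , p∈) | yes refl = contradiction p∈ (not-both (max u) v≁p v∈₀)
          ... | inj₂ (w∈ , p∈) | no u≢u₀ = contradiction
            (near (max u₀) (max u) v∈₀ q∈₀ u∈₀ v≢q (≢-sym u≢v) (λ { refl → q∉K u∈K })
              (not-both (max u) (≁-sym G v≁p) p∈) (not-both (max u) w≁q w∈))
            (avoids u)
            where
            u∈₀ : u ∈ ⟨ u₀ ⟩
            u∈₀ = near K-max (max u₀) u₀∈K w∈K u∈K u₀≢w (≢-sym u≢u₀) (≢-sym u≢w)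
              (avoids u₀) (not-both (max u₀) (≁-sym G w≁q) q∈₀)

          K-w : List (Fin n)
          K-w = filter (λ x → ¬? (x Fin.≟ w)) K

          K-w⇒ : ∀ {x} → x ∈ K-w → x ∈ K × x ≢ w
          K-w⇒ = ∈-filter⁻ (λ x → ¬? (x Fin.≟ w))

          K⊆w∷K-w : K ⊆ w ∷ K-w
          K⊆w∷K-w {x} x∈K with x Fin.≟ w
          ... | yes refl = here refl
          ... | no x≢w   = there (∈-filter⁺ (λ x → ¬? (x Fin.≟ w)) x∈K x≢w)

          q-adj : ∀ {x} → x ∈ K → x ≢ w → Adj G q x
          q-adj {x} x∈K x≢w with x Fin.≟ v
          ... | yes refl = clique-adj G (proj₁ (max u₀)) q∈₀ v∈₀ (≢-sym v≢q)
          ... | no x≢v   = clique-adj G (proj₁ L-max) q∈L (K-vw⊆L x∈K x≢v x≢w) λ { refl → q∉K x∈K }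

          K₀ : List (Fin n)
          K₀ = q ∷ K-w

          K₀-max : IsMaxClique G K₀
          K₀-max = K₀-clique , ℕ.≤-antisym (clique⇒length≤ν G K₀-clique)
            (subst (_≤ length K₀) (proj₂ K-max) (unique-⊆⇒length≤ (clique-unique G (proj₁ K-max)) K⊆w∷K-w))
            where
            K₀-clique : IsClique G K₀
            K₀-clique = All.tabulate (λ x∈ → let x∈K , x≢w = K-w⇒ x∈ in q-adj x∈K x≢w)
              ∷ AllPairs.filter⁺ (λ x → ¬? (x Fin.≟ w)) (proj₁ K-max)

          -- In `K₀`, which is `K` with `w` exchanged for `q`, the vertex `q` can be replaced by
          -- `w`, and `v` by `p`. For any other `u`, the clique `⟨ u ⟩` contains `q`, hence omits
          -- `w`, and therefore contains all of `K₀` except `u`.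
          replace : ∀ {u} → u ∈ K₀ → Replacement K₀ u
          replace (here refl) =
            w , (λ { (here refl) → q∉K w∈K ; (there w∈) → proj₂ (K-w⇒ w∈) refl })
            , λ { (here refl) q≢q → contradiction refl q≢q
                ; (there x∈) _ → let x∈K , x≢w = K-w⇒ x∈ in clique-adj G (proj₁ K-max) w∈K x∈K (≢-sym x≢w) }
          replace {u} (there u∈) with K-w⇒ u∈ | u Fin.≟ v
          ... | _ | yes refl =
            p , (λ { (here refl) → p≢q refl ; (there p∈) → p∉K (proj₁ (K-w⇒ p∈)) })
            , λ { (here refl) _ → clique-adj G (proj₁ L-max) p∈L q∈L p≢q
                ; (there x∈) x≢v → let x∈K , x≢w = K-w⇒ x∈ in
                    clique-adj G (proj₁ L-max) p∈L (K-vw⊆L x∈K x≢v x≢w) λ { refl → p∉K x∈K } }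
          ... | u∈K , u≢w | no u≢v = replacement K₀-max (max u) (there u∈) (avoids u)
            λ { (here refl) _ → q∈u
              ; (there x∈) x≢u → let x∈K , x≢w = K-w⇒ x∈ in
                  near K-max (max u) u∈K w∈K x∈K u≢w (≢-sym x≢u) (≢-sym x≢w)
                    (avoids u) (not-both (max u) (≁-sym G w≁q) q∈u) }
            where
            q∈u : q ∈ ⟨ u ⟩
            q∈u = q∈⟨⟩ u∈K u≢v u≢w

          centre₀ : Centre
          centre₀ = replacements⇒centre K₀-max replace

    -- If every `⟨ u ⟩` with `u` in `K` omits only `u` from `K`, then `K` itself is a centre.
    -- Otherwise some `⟨ v ⟩` omits a second vertex `w`, and a third vertex `u₀` of `K` decides
    -- which of `v` and `w` is exchanged.
    centre : 3 ≤ ν G → Centre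
    centre 3≤ν
      with K , K-max@(K-clique , |K|≡ν) ← ν-attained G
      with Fin.any? (λ v → Fin.any? λ w → (v ∈? K) ×-dec (w ∈? K) ×-dec ¬? (v Fin.≟ w) ×-dec ¬? (w ∈? ⟨ v ⟩))
    ... | no none = replacements⇒centre K-max λ {u} u∈K →
      replacement K-max (max u) u∈K (avoids u) λ {x} x∈K x≢u →
        decidable-stable (x ∈? ⟨ u ⟩) λ x∉ → none (u , x , u∈K , x∈K , ≢-sym x≢u , x∉)
    ... | yes (v , w , v∈K , w∈K , v≢w , w∉L)
      with p , q , p∈L , q∈L , p≢q , v≁p , w≁q ←
             antimatch₂ (max v) (avoids v) w∉L (clique-adj G K-clique v∈K w∈K v≢w)
      with u₀ , u₀∈K , u₀∉vw ← fresh (clique-unique G K-clique) (v ∷ w ∷ []) (subst (3 ≤_) (sym |K|≡ν) 3≤ν)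
      = case Pair.mixed K-max (max v) v∈K w∈K v≢w (avoids v) w∉L p∈L q∈L p≢q v≁p w≁q u₀∈K u₀≢v u₀≢w of λ
        { (inj₁ (v∈₀ , q∈₀)) → Pair.centre₀ K-max (max v) v∈K w∈K v≢w (avoids v) w∉L
            p∈L q∈L p≢q v≁p w≁q u₀∈K u₀≢v u₀≢w v∈₀ q∈₀
        ; (inj₂ (w∈₀ , p∈₀)) → Pair.centre₀ K-max (max v) w∈K v∈K (≢-sym v≢w) w∉L (avoids v)
            q∈L p∈L (≢-sym p≢q) w≁q v≁p u₀∈K u₀≢w u₀≢v w∈₀ p∈₀
        }
      where
      u₀≢v : u₀ ≢ v
      u₀≢v refl = u₀∉vw (here refl)

      u₀≢w : u₀ ≢ w
      u₀≢w refl = u₀∉vw (there (here refl))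

-- A clique, its mates and the apex

record Configuration {n : ℕ} (G : Graph (Fin n)) : Set₁ where
  field
    𝓕-free       : ¬ AntimatchedTriangles G
    K            : Fin n → Set
    K?           : Decidable K
    K-adj        : ∀ {u v} → K u → K v → u ≢ v → Adj G u v
    third        : ∀ u v → ∃ λ w → K w × w ≢ u × w ≢ v
    mate         : Fin n → Fin n
    mate-adj     : ∀ {u x} → K u → K x → x ≢ u → Adj G (mate u) x
    mate≁        : ∀ {u} → K u → G [ mate u ≁ u ]
    mates-stable : ∀ {u v} → K u → K v → u ≢ v → G [ mate u ≁ mate v ]
    apex         : Fin n
    part         : ∀ x → K x ⊎ (∃ λ u → K u × x ≡ mate u) ⊎ x ≡ apex
    apex≢K       : ∀ {u} → K u → apex ≢ u
    apex≢mate    : ∀ {u} → K u → apex ≢ mate u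
    -- `apex-missed` and `not-swappable` record that `K` is a maximum clique of `G`, and `apex-mate`
    -- that the mates form a maximum clique of the covering graph. The analysis of the apex then
    -- proceeds without counting.
    apex-missed  : ∃ λ s → K s × G [ apex ≁ s ]
    apex-mate    : ∃ λ p → K p × Adj G apex (mate p)
    not-swappable : ∀ {s} → K s → (∀ {x} → K x → x ≢ s → Adj G apex x) → ¬ Adj G apex (mate s)

  -- The triangles `apex`, `mate p`, `q` and `s`, `p`, `mate q` would be antimatched.
  not-distinct : ∀ {s p q} → K s → K p → K q → G [ apex ≁ s ] → Adj G apex (mate p) → Adj G apex q →
                 s ≢ p → s ≢ q → ¬ p ≢ q
  not-distinct {s} {p} {q} s∈K p∈K q∈K ≁s ~p ~q s≢p s≢q p≢q =
    𝓕-free (apex , mate p , q , s , p , mate q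
      , (~p , ~q , mate-adj p∈K q∈K (≢-sym p≢q))
      , (K-adj s∈K p∈K s≢p , adj-sym G (mate-adj q∈K s∈K s≢q) , adj-sym G (mate-adj q∈K p∈K p≢q))
      , ≁s , mate≁ p∈K , ≁-sym G (mate≁ q∈K))

  ApexIsolated : Set
  ApexIsolated = ∀ {x} → K x → ¬ Adj G apex x

  ApexPendant : Set
  ApexPendant = ∃ λ q → K q × Adj G apex q × Adj G apex (mate q) ×
    (∀ {x} → K x → x ≢ q → ¬ Adj G apex x × ¬ Adj G apex (mate x))

  -- Suppose that the apex sees `q`, misses `s` and sees `mate p`. Then `s` differs from `q`, so
  -- `not-distinct` leaves `p` equal to `q` or to `s`, and the latter is excluded by
  -- `not-swappable`.
  isolated-or-pendant : ApexIsolated ⊎ ApexPendant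
  isolated-or-pendant with Fin.any? (λ x → K? x ×-dec adj? G apex x)
  ... | no none = inj₁ λ {x} x∈K ~x → none (x , x∈K , ~x)
  ... | yes (q , q∈K , ~q)
    with s , s∈K , ≁s ← apex-missed
    with p , p∈K , ~p ← apex-mate
    with p Fin.≟ q | s Fin.≟ p
  ... | no p≢q | no s≢p = contradiction p≢q
    (not-distinct s∈K p∈K q∈K ≁s ~p ~q s≢p λ { refl → proj₂ ≁s ~q })
  -- Here the apex is adjacent to all of K except s, so the apex and mate s could both replace s.
  ... | no s≢q | yes refl = contradiction ~p (not-swappable s∈K λ {y} y∈K y≢s →
    decidable-stable (adj? G apex y) λ ≁y →
      not-distinct y∈K s∈K q∈K (apex≢K y∈K , ≁y) ~p ~q y≢s (λ { refl → ≁y ~q }) s≢q)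
  ... | yes refl | _ = inj₂ (q , q∈K , ~q , ~p , others)
    where
    misses : ∀ {x} → K x → x ≢ q → ¬ Adj G apex x
    misses {x} x∈K x≢q ~x with s Fin.≟ x
    ... | yes refl = proj₂ ≁s ~x
    ... | no s≢x   = not-distinct s∈K q∈K x∈K ≁s ~p ~x (λ { refl → proj₂ ≁s ~q }) s≢x (≢-sym x≢q)

    others : ∀ {x} → K x → x ≢ q → ¬ Adj G apex x × ¬ Adj G apex (mate x)
    others {x} x∈K x≢q = misses x∈K x≢q , λ ~mate →
      -- The third vertex `y` is missed by the apex and takes the place of `s`.
      let y , y∈K , y≢q , y≢x = third q x
      in not-distinct y∈K x∈K q∈K (apex≢K y∈K , misses y∈K y≢q) ~mate ~q y≢x y≢q x≢q

  -- A vertex of `K` misses the apex and its own mate, a mate misses two other mates, and the apex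
  -- misses all of `K`.
  two-missed : ApexIsolated → ∀ x → ∃₂ λ y y′ → y ≢ y′ × G [ x ≁ y ] × G [ x ≁ y′ ]
  two-missed isolated x with part x
  ... | inj₁ x∈K = apex , mate x , apex≢mate x∈K
                 , (≢-sym (apex≢K x∈K) , isolated x∈K ∘ adj-sym G) , ≁-sym G (mate≁ x∈K)
  ... | inj₂ (inj₁ (u , u∈K , refl))
    with v , v∈K , v≢u , _ ← third u u
    with w , w∈K , w≢u , w≢v ← third u v
    = mate v , mate w , proj₁ (mates-stable v∈K w∈K (≢-sym w≢v))
    , mates-stable u∈K v∈K (≢-sym v≢u) , mates-stable u∈K w∈K (≢-sym w≢u)
  ... | inj₂ (inj₂ refl)
    with s , s∈K , ≁s ← apex-missed
    with t , t∈K , t≢s , _ ← third s s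
    = s , t , ≢-sym t≢s , ≁s , (apex≢K t∈K , isolated t∈K)

-- From a centre to a configuration

record Split {n : ℕ} (G H : Graph (Fin n)) : Set where
  field
    cover  : Covering G H
    𝓕-free : ¬ AntimatchedTriangles G
    3≤ν    : 3 ≤ ν G
    centre : Center.Centre G 𝓕-free

  open Exchange G
  open Center.Centre centre public

  K-clique : IsClique G K
  K-clique = proj₁ K-max

  |K|≡ν : length K ≡ ν G
  |K|≡ν = proj₂ K-max

  K-adj : ∀ {u v} → u ∈ K → v ∈ K → u ≢ v → Adj G u v
  K-adj = clique-adj G K-clique

  mate≁ : ∀ {u} → u ∈ K → G [ mate u ≁ u ]
  mate≁ {u} u∈K with y , y∈K , ≁y ← antimatch₁ K-max (mate∉K u∈K) with y Fin.≟ u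
  ... | yes refl = ≁y
  ... | no y≢u   = contradiction (mate-adj u∈K y∈K y≢u) (proj₂ ≁y)

  mate-injective : ∀ {u v} → u ∈ K → v ∈ K → mate u ≡ mate v → u ≡ v
  mate-injective {u} {v} u∈K v∈K eq = decidable-stable (u Fin.≟ v) λ u≢v →
    proj₂ (mate≁ v∈K) (subst (λ y → Adj G y v) eq (mate-adj u∈K v∈K (≢-sym u≢v)))

  third : ∀ u v → ∃ λ w → w ∈ K × w ≢ u × w ≢ v
  third u v
    with w , w∈K , w∉ ← fresh (clique-unique G K-clique) (u ∷ v ∷ []) (subst (3 ≤_) (sym |K|≡ν) 3≤ν)
    = w , w∈K , (λ { refl → w∉ (here refl) }) , λ { refl → w∉ (there (here refl)) }

  -- For a third vertex `w`, adjacent mates would make `mate u`, `mate v`, `w` and `u`, `v`,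
  -- `mate w` antimatched triangles.
  mates-stable : ∀ {u v} → u ∈ K → v ∈ K → u ≢ v → G [ mate u ≁ mate v ]
  mates-stable {u} {v} u∈K v∈K u≢v with w , w∈K , w≢u , w≢v ← third u v =
    u≢v ∘ mate-injective u∈K v∈K , λ mates-adj →
      𝓕-free (mate u , mate v , w , u , v , mate w
        , (mates-adj , mate-adj u∈K w∈K w≢u , mate-adj v∈K w∈K w≢v)
        , (K-adj u∈K v∈K u≢v , adj-sym G (mate-adj w∈K u∈K (≢-sym w≢u)) , adj-sym G (mate-adj w∈K v∈K (≢-sym w≢v)))
        , mate≁ u∈K , mate≁ v∈K , ≁-sym G (mate≁ w∈K))

  M : List (Fin n)
  M = map mate K

  M-clique : IsClique H M
  M-clique = AllPairs.map⁺ (mkClique (induced mate H) (clique-unique G K-clique)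
    λ u∈K v∈K u≢v → cover (mates-stable u∈K v∈K u≢v))

  |M|≡ν : length M ≡ ν G
  |M|≡ν = trans (length-map mate K) |K|≡ν

  ν≤ν′ : ν G ≤ ν H
  ν≤ν′ = subst (_≤ ν H) |M|≡ν (clique⇒length≤ν H M-clique)

-- With equal clique numbers the mates form a maximum clique of `H`, disjoint from `K`, and exactly
-- one vertex remains for the apex.
record TightSplit {n : ℕ} (G H : Graph (Fin n)) : Set where
  field
    split : Split G H
    ν≡ν′  : ν G ≡ ν H
    n≡    : n ≡ suc (ν G + ν H)

  open Exchange
  open Split split public

  M-max : IsMaxClique H M
  M-max = M-clique , trans |M|≡ν ν≡ν′

  K++M-unique : Unique (K ++ M)
  K++M-unique = Unique.++⁺ (clique-unique G K-clique) (clique-unique H M-clique)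
    λ (x∈K , x∈M) → let u , u∈K , x≡ = ∈-map⁻ mate x∈M in mate∉K u∈K (subst (_∈ K) x≡ x∈K)

  |V|≡ : n ≡ suc (length (K ++ M))
  |V|≡ = trans n≡ (cong suc (sym (trans (length-++ K)
    (cong₂ _+_ |K|≡ν (proj₂ M-max)))))

  private
    outside-point : ∃ λ x → x ∈ allFin n × x ∉ K ++ M
    outside-point = fresh (Unique.allFin⁺ n) (K ++ M)
      (ℕ.≤-reflexive (trans (sym |V|≡) (sym (length-allFin n))))

  apex : Fin n
  apex = proj₁ outside-point

  apex∉K : apex ∉ K
  apex∉K = proj₂ (proj₂ outside-point) ∘ ∈-++⁺ˡ

  apex∉M : apex ∉ M
  apex∉M = proj₂ (proj₂ outside-point) ∘ ∈-++⁺ʳ K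

  apex≢K : ∀ {u} → u ∈ K → apex ≢ u
  apex≢K u∈K refl = apex∉K u∈K

  apex≢mate : ∀ {u} → u ∈ K → apex ≢ mate u
  apex≢mate u∈K eq = apex∉M (subst (_∈ M) (sym eq) (∈-map⁺ mate u∈K))

  -- A vertex beyond these would give `suc n` distinct elements of `Fin n`.
  part : ∀ x → x ∈ K ⊎ (∃ λ u → u ∈ K × x ≡ mate u) ⊎ x ≡ apex
  part x with x ∈? K ++ M | x Fin.≟ apex
  ... | _ | yes x≡apex = inj₂ (inj₂ x≡apex)
  ... | no x∉ | no x≢apex = contradiction
    (unique⇒length≤ {xs = x ∷ apex ∷ K ++ M}
      (∉⇒All≢ (λ { (here x≡) → x≢apex x≡ ; (there x∈) → x∉ x∈ })
        ∷ ∉⇒All≢ (proj₂ (proj₂ outside-point)) ∷ K++M-unique))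
    (ℕ.<⇒≱ (ℕ.≤-reflexive (cong suc |V|≡)))
  ... | yes x∈ | no _ with ∈-++⁻ K x∈
  ...   | inj₁ x∈K = inj₁ x∈K
  ...   | inj₂ x∈M  = inj₂ (inj₁ (∈-map⁻ mate x∈M))

  private
    missed : ∃ λ s → s ∈ K × G [ apex ≁ s ]
    missed = antimatch₁ G K-max apex∉K

    attached : ∃ λ p → p ∈ K × Adj G apex (mate p)
    attached =
      -- By maximality of the mates in `H`, the apex misses one of them in `H`, and so sees it in
      -- `G`.
      let t , t∈M , apex≁t = antimatch₁ H M-max apex∉M
          p , p∈K , t≡ = ∈-map⁻ mate t∈M
      in p , p∈K , subst (Adj G apex) t≡ (covering-sym {G = G} {H} cover apex≁t)

    -- Replacing `s` by both the apex and `mate s` would enlarge the maximum clique `K`.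
    unswappable : ∀ {s} → s ∈ K → (∀ {x} → x ∈ K → x ≢ s → Adj G apex x) → ¬ Adj G apex (mate s)
    unswappable {s} s∈K apex-adj apex~mate = contradiction
      (exchange G K-max ((apex~mate ∷ []) ∷ [] ∷ [])
        (λ { (here refl) → apex∉K ; (there (here refl)) → mate∉K s∈K }) (s ∷ [])
        λ { (here refl) y∈K y∉ → apex-adj y∈K λ { refl → y∉ (here refl) }
          ; (there (here refl)) y∈K y∉ → mate-adj s∈K y∈K λ { refl → y∉ (here refl) } })
      (ℕ.<⇒≱ (s≤s (s≤s z≤n)))

  configuration : Configuration G
  configuration = record
    { 𝓕-free        = 𝓕-free
    ; K             = _∈ K
    ; K?            = _∈? K
    ; K-adj         = K-adj
    ; third         = third
    ; mate          = mate
    ; mate-adj      = mate-adj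
    ; mate≁         = mate≁
    ; mates-stable  = mates-stable
    ; apex          = apex
    ; part          = part
    ; apex≢K        = apex≢K
    ; apex≢mate     = apex≢mate
    ; apex-missed   = missed
    ; apex-mate     = attached
    ; not-swappable = unswappable
    }

-- Induced pentagons

next : Fin 5 → Fin 5
next i = suc (toℕ i) mod 5

pentagon-pairs : ∀ i j → i ≡ j ⊎ (j ≡ next i ⊎ i ≡ next j) ⊎ (j ≡ next (next i) ⊎ i ≡ next (next j))
pentagon-pairs = from-yes (Fin.all? λ i → Fin.all? λ j →
  (i Fin.≟ j) ⊎-dec ((j Fin.≟ next i) ⊎-dec (i Fin.≟ next j))
  ⊎-dec ((j Fin.≟ next (next i)) ⊎-dec (i Fin.≟ next (next j))))

C₅-adj⇒next : ∀ i j → Adj C₅ i j → j ≡ next i ⊎ i ≡ next j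
C₅-adj⇒next = from-yes (Fin.all? λ i → Fin.all? λ j →
  adj? C₅ i j →-dec ((j Fin.≟ next i) ⊎-dec (i Fin.≟ next j)))

next-C₅-adj : ∀ i → Adj C₅ i (next i)
next-C₅-adj = from-yes (Fin.all? λ i → adj? C₅ i (next i))

next⁵ : ∀ i → next (next (next (next (next i)))) ≡ i
next⁵ = from-yes (Fin.all? λ i → next (next (next (next (next i)))) Fin.≟ i)

module _ (G : Graph V) (x : Fin 5 → V)
  (side : ∀ i → Adj G (x i) (x (next i))) (diagonal : ∀ i → ¬ Adj G (x i) (x (next (next i)))) where

  private
    -- If the ends of a diagonal coincided, the side from `i + 2` to `i + 3` would be the diagonal
    -- from `i + 3` to `i + 5`, which is `i` modulo 5.
    diagonal-≢ : ∀ i → x i ≢ x (next (next i))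
    diagonal-≢ i eq = diagonal (next (next (next i)))
      (subst (Adj G _) (trans (sym eq) (cong x (sym (next⁵ i)))) (adj-sym G (side (next (next i)))))

    pentagon-injective : Injective _≡_ _≡_ x
    pentagon-injective {i} {j} eq with pentagon-pairs i j
    ... | inj₁ i≡j                = i≡j
    ... | inj₂ (inj₁ (inj₁ refl)) = contradiction (side i) (adj-irrefl G eq)
    ... | inj₂ (inj₁ (inj₂ refl)) = contradiction (side j) (adj-irrefl G (sym eq))
    ... | inj₂ (inj₂ (inj₁ refl)) = contradiction eq (diagonal-≢ i)
    ... | inj₂ (inj₂ (inj₂ refl)) = contradiction (sym eq) (diagonal-≢ j)

    to : ∀ i j → Adj C₅ i j → Adj G (x i) (x j)
    to i j ij with C₅-adj⇒next i j ij
    ... | inj₁ refl = side i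
    ... | inj₂ refl = adj-sym G (side j)

    from : ∀ i j → Adj G (x i) (x j) → Adj C₅ i j
    from i j xij with pentagon-pairs i j
    ... | inj₁ refl               = contradiction xij (adj-irrefl G refl)
    ... | inj₂ (inj₁ (inj₁ refl)) = next-C₅-adj i
    ... | inj₂ (inj₁ (inj₂ refl)) = adj-sym C₅ {j} (next-C₅-adj j)
    ... | inj₂ (inj₂ (inj₁ refl)) = contradiction xij (diagonal i)
    ... | inj₂ (inj₂ (inj₂ refl)) = contradiction (adj-sym G xij) (diagonal j)

  pentagon : C₅ ↪ G
  pentagon = record { embed = x ; injective = pentagon-injective ; adj⇔ = λ i j → mk⇔ (to i j) (from i j) }

-- Ramsey's theorem for five vertices

-- The part above the diagonal of a symmetric Boolean matrix, row by row.
Matrix : ℕ → Set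
Matrix zero    = ⊤
Matrix (suc n) = Subset n × Matrix n

anyMatrix? : {P : Matrix n → Set} → Decidable P → Dec (∃ P)
anyMatrix? {zero}  P? = map′ (tt ,_) proj₂ (P? tt)
anyMatrix? {suc n} P? = map′ (λ (r , M , p) → (r , M) , p) (λ ((r , M) , p) → r , M , p)
  (anySubset? λ r → anyMatrix? λ M → P? (r , M))

entry : Matrix n → Fin n → Fin n → Bool
entry _       zero    zero    = false
entry (r , _) zero    (suc j) = Vec.lookup r j
entry (r , _) (suc i) zero    = Vec.lookup r i
entry (_ , M) (suc i) (suc j) = entry M i j

matrix : Graph (Fin n) → Matrix n
matrix {zero}  G = tt
matrix {suc n} G = Vec.tabulate (λ j → does (adj? G zero (suc j))) , matrix (induced suc G)

entry⇒adj : (G : Graph (Fin n)) (i j : Fin n) → entry (matrix G) i j ≡ true → Adj G i j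
entry⇒adj G zero (suc j) eq
  with yes ij ← adj? G zero (suc j) | _ ← trans (sym (lookup∘tabulate _ j)) eq = ij
entry⇒adj G (suc i) zero eq = adj-sym G (entry⇒adj G zero (suc i) eq)
entry⇒adj G (suc i) (suc j) eq = entry⇒adj (induced suc G) i j eq

entry⇒¬adj : (G : Graph (Fin n)) (i j : Fin n) → entry (matrix G) i j ≡ false → ¬ Adj G i j
entry⇒¬adj G zero zero _ = adj-irrefl G refl
entry⇒¬adj G zero (suc j) eq
  with no ¬ij ← adj? G zero (suc j) | _ ← trans (sym (lookup∘tabulate _ j)) eq = ¬ij
entry⇒¬adj G (suc i) zero eq = entry⇒¬adj G zero (suc i) eq ∘ adj-sym G
entry⇒¬adj G (suc i) (suc j) eq = entry⇒¬adj (induced suc G) i j eq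

Monochromatic : Matrix n → Bool → Set
Monochromatic M s = ∃ λ i → ∃ λ j → ∃ λ k → i ≢ j × i ≢ k × j ≢ k ×
  entry M i j ≡ s × entry M i k ≡ s × entry M j k ≡ s

monochromatic? : (M : Matrix n) (s : Bool) → Dec (Monochromatic M s)
monochromatic? M s = Fin.any? λ i → Fin.any? λ j → Fin.any? λ k →
  ¬? (i Fin.≟ j) ×-dec ¬? (i Fin.≟ k) ×-dec ¬? (j Fin.≟ k) ×-dec
  (entry M i j Bool.≟ s) ×-dec (entry M i k Bool.≟ s) ×-dec (entry M j k Bool.≟ s)

-- A pentagon passes through all five vertices, so it may start at `0F`, which shortens the search.
Pentagon : Matrix 5 → Set
Pentagon M = ∃ λ x₁ → ∃ λ x₂ → ∃ λ x₃ → ∃ λ x₄ → let x = Vec.lookup (0F ∷ x₁ ∷ x₂ ∷ x₃ ∷ x₄ ∷ []) in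
  (∀ i → entry M (x i) (x (next i)) ≡ true) × (∀ i → entry M (x i) (x (next (next i))) ≡ false)

pentagon? : (M : Matrix 5) → Dec (Pentagon M)
pentagon? M = Fin.any? λ x₁ → Fin.any? λ x₂ → Fin.any? λ x₃ → Fin.any? λ x₄ →
  let x = Vec.lookup (0F ∷ x₁ ∷ x₂ ∷ x₃ ∷ x₄ ∷ []) in
  Fin.all? (λ i → entry M (x i) (x (next i)) Bool.≟ true)
  ×-dec Fin.all? (λ i → entry M (x i) (x (next (next i))) Bool.≟ false)

opaque
  -- Established by evaluating a search through all 1024 matrices; opacity keeps this search from
  -- being unfolded elsewhere.
  ramsey : ∀ M → Monochromatic M true ⊎ Monochromatic M false ⊎ Pentagon M
  ramsey M = decidable-stable (classify? M) λ none → from-no (anyMatrix? (¬? ∘ classify?)) (M , none)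
    where
    classify? : ∀ M → Dec (Monochromatic M true ⊎ Monochromatic M false ⊎ Pentagon M)
    classify? M = monochromatic? M true ⊎-dec monochromatic? M false ⊎-dec pentagon? M

-- The seven-vertex graphs

-- P with, in addition, c adjacent to the a i with i ∈ A.
data Linked (A N : Subset 3) : V₇ → V₇ → Set where
  aa : ∀ {i j} → i ≢ j → Linked A N (a i) (a j)
  ab : ∀ {i j} → i ≢ j → Linked A N (a i) (b j)
  ba : ∀ {i j} → i ≢ j → Linked A N (b i) (a j)
  ac : ∀ {i} → i ∈ₛ A → Linked A N (a i) c
  ca : ∀ {i} → i ∈ₛ A → Linked A N c (a i)
  bc : ∀ {i} → i ∈ₛ N → Linked A N (b i) c
  cb : ∀ {i} → i ∈ₛ N → Linked A N c (b i)

linked? : ∀ A N u v → Dec (Linked A N u v)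
linked? A N (a i) (a j) = map′ aa (λ { (aa i≢j) → i≢j }) (¬? (i Fin.≟ j))
linked? A N (a i) (b j) = map′ ab (λ { (ab i≢j) → i≢j }) (¬? (i Fin.≟ j))
linked? A N (a i) c     = map′ ac (λ { (ac i∈A) → i∈A }) (i ∈ₛ? A)
linked? A N (b i) (a j) = map′ ba (λ { (ba i≢j) → i≢j }) (¬? (i Fin.≟ j))
linked? A N (b _) (b _) = no λ ()
linked? A N (b i) c     = map′ bc (λ { (bc i∈N) → i∈N }) (i ∈ₛ? N)
linked? A N c     (a j) = map′ ca (λ { (ca j∈A) → j∈A }) (j ∈ₛ? A)
linked? A N c     (b j) = map′ cb (λ { (cb j∈N) → j∈N }) (j ∈ₛ? N)
linked? A N c     c     = no λ ()

all₇? : {Q : V₇ → Set} → Decidable Q → Dec (∀ v → Q v)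
all₇? Q? = map′
  (λ (qa , qb , qc) → λ { (a i) → qa i ; (b i) → qb i ; c → qc })
  (λ q → q ∘ a , q ∘ b , q c)
  (Fin.all? (Q? ∘ a) ×-dec Fin.all? (Q? ∘ b) ×-dec Q? c)

Matches : Graph V₇ → (V₇ → V₇) → Subset 3 → Subset 3 → Set
Matches H φ A N = ∀ u v → (Adj H u v → Linked A N (φ u) (φ v)) × (Linked A N (φ u) (φ v) → Adj H u v)

matches? : ∀ H φ A N → Dec (Matches H φ A N)
matches? H φ A N = all₇? λ u → all₇? λ v →
  (adj? H u v →-dec linked? A N (φ u) (φ v)) ×-dec (linked? A N (φ u) (φ v) →-dec adj? H u v)

P₀-matches : Matches P₀ id ∅ ⁅ 0F ⁆
P₀-matches = from-yes (matches? P₀ id ∅ ⁅ 0F ⁆)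

P₁-matches : Matches P₁ id ∅ (⁅ 0F ⁆ ∪ ⁅ 1F ⁆)
P₁-matches = from-yes (matches? P₁ id ∅ (⁅ 0F ⁆ ∪ ⁅ 1F ⁆))

P₂-matches : Matches P₂ id ∅ (⁅ 0F ⁆ ∪ ⁅ 1F ⁆ ∪ ⁅ 2F ⁆)
P₂-matches = from-yes (matches? P₂ id ∅ (⁅ 0F ⁆ ∪ ⁅ 1F ⁆ ∪ ⁅ 2F ⁆))

-- The vertices b₁, b₂, c form the triangle of P₀ᶜ that plays the role of K.
φ : V₇ → V₇
φ (a 0F) = c
φ (a 1F) = b 2F
φ (a 2F) = b 1F
φ (b 0F) = b 0F
φ (b 1F) = a 1F
φ (b 2F) = a 2F
φ c      = a 0F

-- This identifies `P₀ᶜ` as a triangle with its mates and an apex that sees exactly one vertex of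
-- the triangle and the mate of that vertex.
P₀ᶜ-matches : Matches P₀ᶜ φ ⁅ 0F ⁆ ⁅ 0F ⁆
P₀ᶜ-matches = from-yes (matches? P₀ᶜ φ ⁅ 0F ⁆ ⁅ 0F ⁆)

φ-injective : Injective _≡_ _≡_ φ
φ-injective {u} {v} = from-yes (all₇? λ u → all₇? λ v → (φ u ≟₇ φ v) →-dec (u ≟₇ v)) u v

triple : V → V → V → Fin 3 → V
triple x y z 0F = x
triple x y z 1F = y
triple x y z 2F = z

triple-injective : {x y z : V} → x ≢ y → x ≢ z → y ≢ z → Injective _≡_ _≡_ (triple x y z)
triple-injective x≢y x≢z y≢z {0F} {0F} _  = refl
triple-injective x≢y x≢z y≢z {0F} {1F} eq = contradiction eq x≢y
triple-injective x≢y x≢z y≢z {0F} {2F} eq = contradiction eq x≢z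
triple-injective x≢y x≢z y≢z {1F} {0F} eq = contradiction (sym eq) x≢y
triple-injective x≢y x≢z y≢z {1F} {1F} _  = refl
triple-injective x≢y x≢z y≢z {1F} {2F} eq = contradiction eq y≢z
triple-injective x≢y x≢z y≢z {2F} {0F} eq = contradiction (sym eq) x≢z
triple-injective x≢y x≢z y≢z {2F} {1F} eq = contradiction (sym eq) y≢z
triple-injective x≢y x≢z y≢z {2F} {2F} _  = refl

ContainsP : Graph V → Set₁
ContainsP G = ∃ λ H → 𝓟 H × H ↪ G

both : {A B : Set} → A → B → A ⇔ B
both x y = mk⇔ (λ _ → y) (λ _ → x)

neither : {A B : Set} → ¬ A → ¬ B → A ⇔ B
neither ¬x ¬y = mk⇔ (λ x → contradiction x ¬x) (λ y → contradiction y ¬y)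

module Embeddings {n} {G : Graph (Fin n)} (configuration : Configuration G) where
  open Configuration configuration

  -- Three vertices of `K` serve as the `a i`, their mates as the `b i`, and the apex as `c`. All
  -- adjacencies except those of the apex are then determined.
  module _ (u : Fin 3 → Fin n) (u∈K : ∀ i → K (u i)) (u-injective : Injective _≡_ _≡_ u)
    (A N : Subset 3) (A⇔ : ∀ i → i ∈ₛ A ⇔ Adj G apex (u i)) (N⇔ : ∀ i → i ∈ₛ N ⇔ Adj G apex (mate (u i))) where

    open Equivalence using (to; from)

    vertex : V₇ → Fin n
    vertex (a i) = u i
    vertex (b i) = mate (u i)
    vertex c     = apex

    mate-u≢u : ∀ i j → mate (u i) ≢ u j
    mate-u≢u i j eq with u i Fin.≟ u j
    ... | yes ui≡uj = proj₁ (mate≁ (u∈K i)) (trans eq (sym ui≡uj))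
    ... | no  ui≢uj = adj-irrefl G eq (mate-adj (u∈K i) (u∈K j) (≢-sym ui≢uj))

    vertex-injective : Injective _≡_ _≡_ vertex
    vertex-injective {a i} {a j} eq = cong a (u-injective eq)
    vertex-injective {a i} {b j} eq = contradiction (sym eq) (mate-u≢u j i)
    vertex-injective {a i} {c}   eq = contradiction (sym eq) (apex≢K (u∈K i))
    vertex-injective {b i} {a j} eq = contradiction eq (mate-u≢u i j)
    vertex-injective {b i} {b j} eq = cong b (u-injective (decidable-stable (u i Fin.≟ u j)
      λ ui≢uj → proj₁ (mates-stable (u∈K i) (u∈K j) ui≢uj) eq))
    vertex-injective {b i} {c}   eq = contradiction (sym eq) (apex≢mate (u∈K i))
    vertex-injective {c}   {a j} eq = contradiction eq (apex≢K (u∈K j))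
    vertex-injective {c}   {b j} eq = contradiction eq (apex≢mate (u∈K j))
    vertex-injective {c}   {c}   _  = refl

    linked⇒adj : ∀ {x y} → Linked A N x y → Adj G (vertex x) (vertex y)
    linked⇒adj (aa i≢j) = K-adj (u∈K _) (u∈K _) (i≢j ∘ u-injective)
    linked⇒adj (ab i≢j) = adj-sym G (mate-adj (u∈K _) (u∈K _) (i≢j ∘ u-injective))
    linked⇒adj (ba i≢j) = mate-adj (u∈K _) (u∈K _) (≢-sym i≢j ∘ u-injective)
    linked⇒adj (ac i∈A) = adj-sym G (to (A⇔ _) i∈A)
    linked⇒adj (ca i∈A) = to (A⇔ _) i∈A
    linked⇒adj (bc i∈N) = adj-sym G (to (N⇔ _) i∈N)
    linked⇒adj (cb i∈N) = to (N⇔ _) i∈N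

    adj⇒linked : ∀ x y → Adj G (vertex x) (vertex y) → Linked A N x y
    adj⇒linked (a i) (a j) xy = aa λ { refl → adj-irrefl G refl xy }
    adj⇒linked (a i) (b j) xy = ab λ { refl → proj₂ (mate≁ (u∈K i)) (adj-sym G xy) }
    adj⇒linked (a i) c     xy = ac (from (A⇔ i) (adj-sym G xy))
    adj⇒linked (b i) (a j) xy = ba λ { refl → proj₂ (mate≁ (u∈K i)) xy }
    adj⇒linked (b i) (b j) xy with u i Fin.≟ u j
    ... | yes ui≡uj = contradiction xy (adj-irrefl G (cong mate ui≡uj))
    ... | no  ui≢uj = contradiction xy (proj₂ (mates-stable (u∈K i) (u∈K j) ui≢uj))
    adj⇒linked (b i) c     xy = bc (from (N⇔ i) (adj-sym G xy))
    adj⇒linked c     (a j) xy = ca (from (A⇔ j) xy)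
    adj⇒linked c     (b j) xy = cb (from (N⇔ j) xy)
    adj⇒linked c     c     xy = contradiction xy (adj-irrefl G refl)

    matches⇒↪ : ∀ {H ψ} → Injective _≡_ _≡_ ψ → Matches H ψ A N → H ↪ G
    matches⇒↪ {ψ = ψ} ψ-injective matches = record
      { embed     = vertex ∘ ψ
      ; injective = ψ-injective ∘ vertex-injective
      ; adj⇔      = λ x y → mk⇔ (linked⇒adj ∘ proj₁ (matches x y))
                                (proj₂ (matches x y) ∘ adj⇒linked (ψ x) (ψ y))
      }

  pendant⇒P₀ᶜ : ApexPendant → P₀ᶜ ↪ G
  pendant⇒P₀ᶜ (q , q∈K , ~q , ~mate-q , others)
    with v , v∈K , v≢q , _ ← third q q
    with w , w∈K , w≢q , w≢v ← third q v
    = matches⇒↪ (triple q v w) (λ { 0F → q∈K ; 1F → v∈K ; 2F → w∈K })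
        (triple-injective (≢-sym v≢q) (≢-sym w≢q) (≢-sym w≢v)) ⁅ 0F ⁆ ⁅ 0F ⁆
        (λ { 0F → both (from-yes (0F ∈ₛ? ⁅ 0F ⁆)) ~q
           ; 1F → neither (from-no (1F ∈ₛ? ⁅ 0F ⁆)) (proj₁ (others v∈K v≢q))
           ; 2F → neither (from-no (2F ∈ₛ? ⁅ 0F ⁆)) (proj₁ (others w∈K w≢q)) })
        (λ { 0F → both (from-yes (0F ∈ₛ? ⁅ 0F ⁆)) ~mate-q
           ; 1F → neither (from-no (1F ∈ₛ? ⁅ 0F ⁆)) (proj₂ (others v∈K v≢q))
           ; 2F → neither (from-no (2F ∈ₛ? ⁅ 0F ⁆)) (proj₂ (others w∈K w≢q)) })
        φ-injective P₀ᶜ-matches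

  isolated⇒P : ApexIsolated → ContainsP G
  isolated⇒P isolated
    with p , p∈K , ~p ← apex-mate
    with v , v∈K , v≢p , _ ← third p p
    with w , w∈K , w≢p , w≢v ← third p v
    = result
    where
    build : ∀ {x y z} → K x → K y → K z → x ≢ y → x ≢ z → y ≢ z → ∀ {H} N → Matches H id ∅ N →
            (∀ i → i ∈ₛ N ⇔ Adj G apex (mate (triple x y z i))) → H ↪ G
    build {x} {y} {z} x∈K y∈K z∈K x≢y x≢z y≢z N matches N⇔ =
      matches⇒↪ (triple x y z) triple∈K (triple-injective x≢y x≢z y≢z) ∅ N
        (λ i → neither ∉⊥ (isolated (triple∈K i))) N⇔ id matches
      where
      triple∈K : ∀ i → K (triple x y z i)
      triple∈K = λ { 0F → x∈K ; 1F → y∈K ; 2F → z∈K }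

    result : ContainsP G
    result with adj? G apex (mate v) | adj? G apex (mate w)
    ... | no ≁v | no ≁w = P₀ , P₀∈𝓟 ,
      build p∈K v∈K w∈K (≢-sym v≢p) (≢-sym w≢p) (≢-sym w≢v) ⁅ 0F ⁆ P₀-matches
        λ { 0F → both (from-yes (0F ∈ₛ? ⁅ 0F ⁆)) ~p
          ; 1F → neither (from-no (1F ∈ₛ? ⁅ 0F ⁆)) ≁v
          ; 2F → neither (from-no (2F ∈ₛ? ⁅ 0F ⁆)) ≁w }
    ... | yes ~v | no ≁w = P₁ , P₁∈𝓟 ,
      build p∈K v∈K w∈K (≢-sym v≢p) (≢-sym w≢p) (≢-sym w≢v) (⁅ 0F ⁆ ∪ ⁅ 1F ⁆) P₁-matches
        λ { 0F → both (from-yes (0F ∈ₛ? ⁅ 0F ⁆ ∪ ⁅ 1F ⁆)) ~p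
          ; 1F → both (from-yes (1F ∈ₛ? ⁅ 0F ⁆ ∪ ⁅ 1F ⁆)) ~v
          ; 2F → neither (from-no (2F ∈ₛ? ⁅ 0F ⁆ ∪ ⁅ 1F ⁆)) ≁w }
    -- `v` and `w` trade places, so that the mates seen by the apex come first.
    ... | no ≁v | yes ~w = P₁ , P₁∈𝓟 ,
      build p∈K w∈K v∈K (≢-sym w≢p) (≢-sym v≢p) w≢v (⁅ 0F ⁆ ∪ ⁅ 1F ⁆) P₁-matches
        λ { 0F → both (from-yes (0F ∈ₛ? ⁅ 0F ⁆ ∪ ⁅ 1F ⁆)) ~p
          ; 1F → both (from-yes (1F ∈ₛ? ⁅ 0F ⁆ ∪ ⁅ 1F ⁆)) ~w
          ; 2F → neither (from-no (2F ∈ₛ? ⁅ 0F ⁆ ∪ ⁅ 1F ⁆)) ≁v }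
    ... | yes ~v | yes ~w = P₂ , P₂∈𝓟 ,
      build p∈K v∈K w∈K (≢-sym v≢p) (≢-sym w≢p) (≢-sym w≢v) (⁅ 0F ⁆ ∪ ⁅ 1F ⁆ ∪ ⁅ 2F ⁆) P₂-matches
        λ { 0F → both (from-yes (0F ∈ₛ? ⁅ 0F ⁆ ∪ ⁅ 1F ⁆ ∪ ⁅ 2F ⁆)) ~p
          ; 1F → both (from-yes (1F ∈ₛ? ⁅ 0F ⁆ ∪ ⁅ 1F ⁆ ∪ ⁅ 2F ⁆)) ~v
          ; 2F → both (from-yes (2F ∈ₛ? ⁅ 0F ⁆ ∪ ⁅ 1F ⁆ ∪ ⁅ 2F ⁆)) ~w }

  isolated⇒mate : ApexIsolated → ∀ {y} → Adj G apex y → ∃ λ p → K p × y ≡ mate p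
  isolated⇒mate isolated {y} ~y with part y
  ... | inj₁ y∈K           = contradiction ~y (isolated y∈K)
  ... | inj₂ (inj₁ y-mate) = y-mate
  ... | inj₂ (inj₂ y≡apex) = contradiction ~y (adj-irrefl G (sym y≡apex))

  -- The neighbours of an isolated apex are mates, and `apex`, `mate p`, `p′`, `p`, `mate p′` is an
  -- induced pentagon.
  isolated⇒C₅ : ApexIsolated → ∀ {y y′} → y ≢ y′ → Adj G apex y → Adj G apex y′ → C₅ ↪ G
  isolated⇒C₅ isolated {y} {y′} y≢y′ ~y ~y′
    with p , p∈K , refl ← isolated⇒mate isolated ~y
    with p′ , p′∈K , refl ← isolated⇒mate isolated ~y′
    = pentagon G (Vec.lookup (apex ∷ mate p ∷ p′ ∷ p ∷ mate p′ ∷ []))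
        (λ { 0F → ~y
           ; 1F → mate-adj p∈K p′∈K (≢-sym p≢p′)
           ; 2F → K-adj p′∈K p∈K (≢-sym p≢p′)
           ; 3F → adj-sym G (mate-adj p′∈K p∈K p≢p′)
           ; 4F → adj-sym G ~y′ })
        (λ { 0F → isolated p′∈K
           ; 1F → proj₂ (mate≁ p∈K)
           ; 2F → proj₂ (mate≁ p′∈K) ∘ adj-sym G
           ; 3F → isolated p∈K ∘ adj-sym G
           ; 4F → proj₂ (mates-stable p∈K p′∈K p≢p′) ∘ adj-sym G })
    where
    p≢p′ : p ≢ p′
    p≢p′ refl = y≢y′ refl

-- Vertex-critical pairs

Exceptional : Graph V → Graph V → Set₁
Exceptional B R =
  (AntimatchedTriangles B ⊎ AntimatchedTriangles R)
  ⊎ (C₅ ↪ B × C₅ ↪ R)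
  ⊎ (P₀ᶜ ↪ B × P₀ᶜ ↪ R)
  ⊎ (P₀ᶜ ↪ B × ContainsP R)
  ⊎ (P₀ᶜ ↪ R × ContainsP B)

module _ {B R : Graph (Fin n)} (B⊎R : Covering B R) (R⊎B : Covering R B)
  (B-configuration : Configuration B) (R-configuration : Configuration R) where
  private
    module B = Configuration B-configuration
    module R = Configuration R-configuration
    module B↪ = Embeddings B-configuration
    module R↪ = Embeddings R-configuration

  configurations⇒exceptional : Exceptional B R
  configurations⇒exceptional with B.isolated-or-pendant | R.isolated-or-pendant
  ... | inj₂ B-pendant | inj₂ R-pendant =
    inj₂ (inj₂ (inj₁ (B↪.pendant⇒P₀ᶜ B-pendant , R↪.pendant⇒P₀ᶜ R-pendant)))
  ... | inj₂ B-pendant | inj₁ R-isolated =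
    inj₂ (inj₂ (inj₂ (inj₁ (B↪.pendant⇒P₀ᶜ B-pendant , R↪.isolated⇒P R-isolated))))
  ... | inj₁ B-isolated | inj₂ R-pendant =
    inj₂ (inj₂ (inj₂ (inj₂ (R↪.pendant⇒P₀ᶜ R-pendant , B↪.isolated⇒P B-isolated))))
  ... | inj₁ B-isolated | inj₁ R-isolated =
    -- Each configuration supplies two non-neighbours of the apex of the other one; by covering,
    -- that apex sees both of them in its own graph.
    let y , y′ , y≢y′ , ≁y , ≁y′ = R.two-missed R-isolated B.apex
        z , z′ , z≢z′ , ≁z , ≁z′ = B.two-missed B-isolated R.apex
    in inj₂ (inj₁ ( B↪.isolated⇒C₅ B-isolated y≢y′ (R⊎B ≁y) (R⊎B ≁y′)
                  , R↪.isolated⇒C₅ R-isolated z≢z′ (B⊎R ≁z) (B⊎R ≁z′)))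

-- If `G` had no edge, `H` would be complete.
ν<n⇒2≤ν : {G H : Graph (Fin n)} → Covering G H → ν H < n → 2 ≤ ν G
ν<n⇒2≤ν {n} {G} {H} cover νH<n = ℕ.≰⇒> λ νG≤1 → contradiction
  (subst (_≤ ν H) (length-allFin n) (clique⇒length≤ν H (mkClique H (Unique.allFin⁺ n)
    λ {u} {v} _ _ u≢v → cover (u≢v , λ uv →
      ℕ.<⇒≱ (clique⇒length≤ν G {u ∷ v ∷ []} ((uv ∷ []) ∷ [] ∷ [])) νG≤1))))
  (ℕ.<⇒≱ νH<n)

small⇒C₅ : (G H : Graph (Fin 5)) → Covering G H → ν G ≤ 2 → ν H ≤ 2 → C₅ ↪ G
small⇒C₅ G H cover νG≤2 νH≤2 with ramsey (matrix G)
... | inj₁ (i , j , k , _ , _ , _ , ij , ik , jk) = contradiction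
  (clique⇒length≤ν G {i ∷ j ∷ k ∷ []}
    ((entry⇒adj G i j ij ∷ entry⇒adj G i k ik ∷ []) ∷ (entry⇒adj G j k jk ∷ []) ∷ [] ∷ []))
  (ℕ.<⇒≱ (s≤s νG≤2))
... | inj₂ (inj₁ (i , j , k , i≢j , i≢k , j≢k , ij , ik , jk)) = contradiction
  (clique⇒length≤ν H {i ∷ j ∷ k ∷ []}
    ((cover (i≢j , entry⇒¬adj G i j ij) ∷ cover (i≢k , entry⇒¬adj G i k ik) ∷ [])
      ∷ (cover (j≢k , entry⇒¬adj G j k jk) ∷ []) ∷ [] ∷ []))
  (ℕ.<⇒≱ (s≤s νH≤2))
... | inj₂ (inj₂ (x₁ , x₂ , x₃ , x₄ , side , diagonal)) =
  pentagon G x (λ i → entry⇒adj G (x i) (x (next i)) (side i))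
    (λ i → entry⇒¬adj G (x i) (x (next (next i))) (diagonal i))
  where
  x : Fin 5 → Fin 5
  x = Vec.lookup (0F ∷ x₁ ∷ x₂ ∷ x₃ ∷ x₄ ∷ [])

Avoidable : Graph (Fin n) → Set
Avoidable G = ∀ u → ∃ λ L → IsMaxClique G L × u ∉ L

critical⇒exceptional : {B R : Graph (Fin n)} → Covering B R → n ≡ suc (ν B + ν R) →
                       Avoidable B → Avoidable R → Exceptional B R
critical⇒exceptional {n} {B} {R} B⊎R n≡ B-avoidable R-avoidable
  with antimatchedTriangles? B | antimatchedTriangles? R
... | yes B-𝓕 | _       = inj₁ (inj₁ B-𝓕)
... | no _    | yes R-𝓕 = inj₁ (inj₂ R-𝓕)
... | no B-free | no R-free = result
  where
  R⊎B : Covering R B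
  R⊎B = covering-sym {G = B} {R} B⊎R

  B-split : 3 ≤ ν B → Split B R
  B-split 3≤ν = record
    { cover = B⊎R ; 𝓕-free = B-free ; 3≤ν = 3≤ν ; centre = Center.centre B B-free B-avoidable 3≤ν }

  R-split : 3 ≤ ν R → Split R B
  R-split 3≤ν = record
    { cover = R⊎B ; 𝓕-free = R-free ; 3≤ν = 3≤ν ; centre = Center.centre R R-free R-avoidable 3≤ν }

  large : 3 ≤ ν B → 3 ≤ ν R → Exceptional B R
  large 3≤νB 3≤νR = configurations⇒exceptional B⊎R R⊎B
    (TightSplit.configuration (record { split = B-split 3≤νB ; ν≡ν′ = ν≡ ; n≡ = n≡ }))
    (TightSplit.configuration (record
      { split = R-split 3≤νR ; ν≡ν′ = sym ν≡ ; n≡ = trans n≡ (cong suc (ℕ.+-comm (ν B) (ν R))) }))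
    where
    ν≡ : ν B ≡ ν R
    ν≡ = ℕ.≤-antisym (Split.ν≤ν′ (B-split 3≤νB)) (Split.ν≤ν′ (R-split 3≤νR))

  small : ν B ≡ 2 → ν R ≡ 2 → C₅ ↪ B × C₅ ↪ R
  -- The vertex count becomes 2 + 2 + 1, so `ramsey` is available.
  small νB≡2 νR≡2 with refl ← trans n≡ (cong suc (cong₂ _+_ νB≡2 νR≡2)) =
    small⇒C₅ B R B⊎R (ℕ.≤-reflexive νB≡2) (ℕ.≤-reflexive νR≡2) ,
    small⇒C₅ R B R⊎B (ℕ.≤-reflexive νR≡2) (ℕ.≤-reflexive νB≡2)

  result : Exceptional B R
  result with 3 ℕ.≤? ν B | 3 ℕ.≤? ν R
  -- Since the mates in one graph form a clique of the other, one clique number of at least 3 forces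
  -- both to be.
  ... | yes 3≤νB | _        = large 3≤νB (ℕ.≤-trans 3≤νB (Split.ν≤ν′ (B-split 3≤νB)))
  ... | no _     | yes 3≤νR = large (ℕ.≤-trans 3≤νR (Split.ν≤ν′ (R-split 3≤νR))) 3≤νR
  ... | no 3≰νB  | no 3≰νR  = inj₂ (inj₁ (small
    (ℕ.≤-antisym (ℕ.≤-pred (ℕ.≰⇒> 3≰νB))
      (ν<n⇒2≤ν {G = B} B⊎R (subst (ν R <_) (sym n≡) (s≤s (ℕ.m≤n+m (ν R) (ν B))))))
    (ℕ.≤-antisym (ℕ.≤-pred (ℕ.≰⇒> 3≰νR))
      (ν<n⇒2≤ν {G = R} R⊎B (subst (ν B <_) (sym n≡) (s≤s (ℕ.m≤m+n (ν B) (ν R))))))))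

-- Reduction to vertex-critical pairs

module _ (f : W → V) (f-injective : Injective _≡_ _≡_ f) where

  antimatchedTriangles-induced : {G : Graph V} → AntimatchedTriangles (induced f G) → AntimatchedTriangles G
  antimatchedTriangles-induced (x₁ , x₂ , x₃ , y₁ , y₂ , y₃ , xs , ys , ≁₁ , ≁₂ , ≁₃) =
    f x₁ , f x₂ , f x₃ , f y₁ , f y₂ , f y₃ , xs , ys
    , Product.map₁ (_∘ f-injective) ≁₁ , Product.map₁ (_∘ f-injective) ≁₂ , Product.map₁ (_∘ f-injective) ≁₃

  containsP-induced : {G : Graph V} → ContainsP (induced f G) → ContainsP G
  containsP-induced (H , H∈𝓟 , e) = H , H∈𝓟 , ↪-induced f f-injective e

  exceptional-induced : {B R : Graph V} → Exceptional (induced f B) (induced f R) → Exceptional B R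
  exceptional-induced {B} {R} = Sum.map
    (Sum.map (antimatchedTriangles-induced {B}) (antimatchedTriangles-induced {R}))
    (Sum.map (Product.map lift lift)
      (Sum.map (Product.map lift lift)
        (Sum.map (Product.map lift containsP-induced) (Product.map lift containsP-induced))))
    where
    lift : {U : Set} {H : Graph U} {G : Graph V} → H ↪ induced f G → H ↪ G
    lift = ↪-induced f f-injective

-- A maximum clique of the graph with `u` deleted is still maximum in `G`, because the deletion does
-- not lower the clique number.
avoidable : (G : Graph (Fin (suc n))) → (∀ u → ν G ≤ ν (induced (punchIn u) G)) → Avoidable G
avoidable G ν≤ u with xs , clique , |xs|≡ ← ν-attained (induced (punchIn u) G) =
  map (punchIn u) xs
  , (AllPairs.map⁺ clique , trans (length-map (punchIn u) xs)
      (trans |xs|≡ (ℕ.≤-antisym (ν-induced≤ν (punchIn u) G) (ν≤ u))))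
  , λ u∈ → let x , _ , u≡ = ∈-map⁻ (punchIn u) u∈ in Fin.punchInᵢ≢i u x (sym u≡)

-- Induction by deleting a vertex. If the bound fails for the whole graph but holds after every
-- deletion, then `n ≤ ν (B - u) + ν (R - u) ≤ ν B + ν R ≤ n` for each `u`, with subtraction
-- denoting deletion. Equality throughout makes the pair vertex-critical.
exceptional-or-covered : ∀ n (B R : Graph (Fin n)) → Covering B R →
                         Exceptional B R ⊎ n ≤ ν B + ν R
exceptional-or-covered zero    B R B⊎R = inj₂ z≤n
exceptional-or-covered (suc n) B R B⊎R with suc n ℕ.≤? ν B + ν R
... | yes covered = inj₂ covered
... | no ¬covered with Fin.any? (λ u → ¬? (n ℕ.≤? ν (induced (punchIn u) B) + ν (induced (punchIn u) R)))
...   | yes (u , ¬covered-u) = inj₁ (exceptional-induced (punchIn u) (Fin.punchIn-injective u _ _)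
  (Sum.fromInj₁ (λ covered-u → contradiction covered-u ¬covered-u)
    (exceptional-or-covered n _ _ λ (x≢y , x≁y) → B⊎R (x≢y ∘ Fin.punchIn-injective u _ _ , x≁y))))
...   | no none = inj₁ (critical⇒exceptional B⊎R (cong suc n≡) (avoidable B νB≤) (avoidable R νR≤))
  where
  covered : ∀ u → n ≤ ν (induced (punchIn u) B) + ν (induced (punchIn u) R)
  covered u = decidable-stable (_ ℕ.≤? _) λ ¬covered-u → none (u , ¬covered-u)

  νs≤n : ν B + ν R ≤ n
  νs≤n = ℕ.≤-pred (ℕ.≰⇒> ¬covered)

  n≡ : n ≡ ν B + ν R
  n≡ = ℕ.≤-antisym (ℕ.≤-trans (covered zero)
    (ℕ.+-mono-≤ (ν-induced≤ν (punchIn zero) B) (ν-induced≤ν (punchIn zero) R))) νs≤n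

  νB≤ : ∀ u → ν B ≤ ν (induced (punchIn u) B)
  νB≤ u = ℕ.+-cancelʳ-≤ (ν R) _ _ (ℕ.≤-trans νs≤n
    (ℕ.≤-trans (covered u) (ℕ.+-monoʳ-≤ _ (ν-induced≤ν (punchIn u) R))))

  νR≤ : ∀ u → ν R ≤ ν (induced (punchIn u) R)
  νR≤ u = ℕ.+-cancelˡ-≤ (ν B) _ _ (ℕ.≤-trans νs≤n
    (ℕ.≤-trans (covered u) (ℕ.+-monoˡ-≤ _ (ν-induced≤ν (punchIn u) B))))

-- Return to the containments of the theorem

triangle-adj : (G : Graph V) {x y z : V} → Triangle G x y z →
               ∀ i j → i ≢ j → Adj G (triple x y z i) (triple x y z j)
triangle-adj G _              0F 0F i≢i = contradiction refl i≢i
triangle-adj G (xy , _ , _)   0F 1F _   = xy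
triangle-adj G (_ , xz , _)   0F 2F _   = xz
triangle-adj G (xy , _ , _)   1F 0F _   = adj-sym G xy
triangle-adj G _              1F 1F i≢i = contradiction refl i≢i
triangle-adj G (_ , _ , yz)   1F 2F _   = yz
triangle-adj G (_ , xz , _)   2F 0F _   = adj-sym G xz
triangle-adj G (_ , _ , yz)   2F 1F _   = adj-sym G yz
triangle-adj G _              2F 2F i≢i = contradiction refl i≢i

antimatchedTriangles⇒𝓕 : (G : Graph (Fin n)) → AntimatchedTriangles G → ContainsMember G 𝓕
antimatchedTriangles⇒𝓕 {n} G (x₁ , x₂ , x₃ , y₁ , y₂ , y₃ , xs , ys , ≁₁ , ≁₂ , ≁₃) =
  induced f G
  , record { a-clique = triangle-adj G xs ; b-clique = triangle-adj G ys ; a-b = proj₂ ∘ x≁y }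
  , ↪⇒Contains V₆-searchable {G}
      (record { embed = f ; injective = f-injective ; adj⇔ = λ _ _ → mk⇔ id id })
  where
  x y : Fin 3 → Fin n
  x = triple x₁ x₂ x₃
  y = triple y₁ y₂ y₃

  f : V₆ → Fin n
  f (a i) = x i
  f (b i) = y i

  x≁y : ∀ i → G [ x i ≁ y i ]
  x≁y 0F = ≁₁
  x≁y 1F = ≁₂
  x≁y 2F = ≁₃

  -- For distinct indices, `x i` equal to `y j` would be adjacent to `y i`, since the `y` form a
  -- triangle.
  x≢y : ∀ i j → x i ≢ y j
  x≢y i j eq with i Fin.≟ j
  ... | yes refl = proj₁ (x≁y i) eq
  ... | no i≢j   = proj₂ (x≁y i) (subst (λ v → Adj G v (y i)) (sym eq) (triangle-adj G ys j i (≢-sym i≢j)))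

  f-injective : Injective _≡_ _≡_ f
  f-injective {a i} {a j} eq = cong a (decidable-stable (i Fin.≟ j)
    λ i≢j → adj-irrefl G eq (triangle-adj G xs i j i≢j))
  f-injective {a i} {b j} eq = contradiction eq (x≢y i j)
  f-injective {b i} {a j} eq = contradiction (sym eq) (x≢y j i)
  f-injective {b i} {b j} eq = cong b (decidable-stable (i Fin.≟ j)
    λ i≢j → adj-irrefl G eq (triangle-adj G ys i j i≢j))

mainTheorem1 : (n : ℕ) (B R : Graph (Fin n)) →
    Additive B R
    ⊎ (ContainsMember B 𝓕 ⊎ ContainsMember R 𝓕)
    ⊎ (Contains B C₅ × Contains R C₅)
    ⊎ (Contains B P₀ᶜ × Contains R P₀ᶜ)
    ⊎ (Contains B P₀ᶜ × ContainsMember R 𝓟)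
    ⊎ (Contains R P₀ᶜ × ContainsMember B 𝓟)
mainTheorem1 n B R
  with anySubset? (λ X → ¬? (ν (union B R ↾ X) ℕ.≤? ν (B ↾ X) + ν (R ↾ X)))
... | no none = inj₁ λ X →
  subst₂ _≤_ (ν≡ω (union B R ↾ X)) (cong₂ _+_ (ν≡ω (B ↾ X)) (ν≡ω (R ↾ X)))
    (decidable-stable (_ ℕ.≤? _) λ ¬additive → none (X , ¬additive))
-- The violating set `X` is narrowed to a maximum clique `U` of the union, on which `B` and `R`
-- cover all pairs.
... | yes (X , ¬additive) with U , U-clique , |U|≡ν ← ν-attained (union B R ↾ X) = inj₂ (contained exceptional)
  where
  U-unique : Unique U
  U-unique = clique-unique (union B R ↾ X) U-clique

  embedding : Fin (length U) → Fin n
  embedding = element X ∘ lookup U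

  restricted : Exceptional (induced embedding B) (induced embedding R)
  restricted = Sum.fromInj₁
    -- The bound on `U` would extend to `X`, because restricting to `U` keeps the clique number of
    -- the union and cannot raise those of `B` and `R`.
    (λ covered → contradiction (subst (_≤ ν (B ↾ X) + ν (R ↾ X)) |U|≡ν (ℕ.≤-trans covered
      (ℕ.+-mono-≤ (ν-induced≤ν (lookup U) (B ↾ X)) (ν-induced≤ν (lookup U) (R ↾ X))))) ¬additive)
    (exceptional-or-covered (length U) (induced embedding B) (induced embedding R) λ (i≢j , i≁j) →
      Sum.[ (λ ij → contradiction ij i≁j) , id ]
        (clique-adj (union B R ↾ X) U-clique (∈-lookup _) (∈-lookup _) (i≢j ∘ lookup-injective U-unique)))

  exceptional : Exceptional B R
  exceptional = exceptional-induced embedding (lookup-injective U-unique ∘ element-injective X) restricted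

  contains-C₅ : ∀ {G : Graph (Fin n)} → C₅ ↪ G → Contains G C₅
  contains-C₅ = ↪⇒Contains Fin.any?

  contains-P₀ᶜ : ∀ {G : Graph (Fin n)} → P₀ᶜ ↪ G → Contains G P₀ᶜ
  contains-P₀ᶜ = ↪⇒Contains V₇-searchable

  contains-𝓟 : ∀ {G : Graph (Fin n)} → ContainsP G → ContainsMember G 𝓟
  contains-𝓟 (H , H∈𝓟 , e) = H , H∈𝓟 , ↪⇒Contains V₇-searchable e

  contained : Exceptional B R → _
  contained = Sum.map
    (Sum.map (antimatchedTriangles⇒𝓕 B) (antimatchedTriangles⇒𝓕 R))
    (Sum.map (Product.map contains-C₅ contains-C₅)
      (Sum.map (Product.map contains-P₀ᶜ contains-P₀ᶜ)
        (Sum.map (Product.map contains-P₀ᶜ contains-𝓟) (Product.map contains-P₀ᶜ contains-𝓟))))
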